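{- For every nonnegative integer $k\ne 1$, the set $\mathscr{D}\cap[0,k]$ is a well-ordered subset of $\mathbb{R}$ of order type $\omega^k$, while $\mathscr{D}\cap[0,1]$ has order type $\omega+1$.
   Context: $\|n\|$ is the complexity of a positive integer $n$: the least number of $1$'s needed to write $n$ using $1$, $+$, $\times$ and parentheses; $\delta(n)=\|n\|-3\log_3 n$ is its defect; $\mathscr{D}=\{\delta(n):n\ge1\}$ is the defect set. -}

module Defs where

open import Data.Nat using (ℕ; zero; suc; _+_; _*_; _^_; _≤_; _<_)
open import Data.Product using (Σ; _×_; _,_)
open import Data.Sum using (_⊎_)
open import Data.Empty using (⊥)
open import Data.Unit using (⊤)
open import Data.Maybe using (Maybe; just; nothing)
open import Data.Vec using (Vec; []; _∷_)
open import Relation.Nullary using (¬_)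
open import Relation.Binary.PropositionalEquality using (_≡_)

data Expr : Set where
  one : Expr
  _⊕_ : Expr → Expr → Expr
  _⊗_ : Expr → Expr → Expr

eval : Expr → ℕ
eval one = 1
eval (e ⊕ f) = eval e + eval f
eval (e ⊗ f) = eval e * eval f

ones : Expr → ℕ
ones one = 1
ones (e ⊕ f) = ones e + ones f
ones (e ⊗ f) = ones e + ones f

IsCpx : ℕ → ℕ → Set
IsCpx n c = (Σ Expr λ e → (eval e ≡ n) × (ones e ≡ c))
          × (∀ e → eval e ≡ n → c ≤ ones e)

cube : ℕ → ℕ
cube n = n * n * n

-- δ(n) ≤ δ(m)  ⇔  ‖n‖ - 3log₃ n ≤ ‖m‖ - 3log₃ m  ⇔  3^‖n‖ · m³ ≤ 3^‖m‖ · n³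
DefectLe : ℕ → ℕ → Set
DefectLe n m = ∀ cn cm → IsCpx n cn → IsCpx m cm →
               3 ^ cn * cube m ≤ 3 ^ cm * cube n

DefectLt : ℕ → ℕ → Set
DefectLt n m = DefectLe n m × ¬ DefectLe m n

DefectEq : ℕ → ℕ → Set
DefectEq n m = DefectLe n m × DefectLe m n

-- δ(n) ∈ [0,k]  ⇔  n ≥ 1, 0 ≤ ‖n‖ - 3log₃ n ≤ k  ⇔  n³ ≤ 3^‖n‖ ≤ 3^k · n³
DefectIn0k : ℕ → ℕ → Set
DefectIn0k k n = Σ ℕ λ c → IsCpx n c × (cube n ≤ 3 ^ c) × (3 ^ c ≤ 3 ^ k * cube n)

-- The set 𝒟 ∩ [0,k] (ordered as a subset of ℝ) is order-isomorphic to the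
-- strict linear order (I, _<I_): f picks for each index a representative n
-- with δ(n) ∈ [0,k]; f is an order embedding and every defect in [0,k] is hit.
HasOrderType : ℕ → (I : Set) → (I → I → Set) → Set
HasOrderType k I _<I_ =
  Σ (I → ℕ) λ f →
    (∀ i → DefectIn0k k (f i))
    × (∀ i j → (i <I j → DefectLt (f i) (f j)) × (DefectLt (f i) (f j) → i <I j))
    × (∀ n → DefectIn0k k n → Σ I λ i → DefectEq n (f i))

-- ω^k realised as ℕ^k under lexicographic order (first coordinate most significant).
_<lex_ : ∀ {k} → Vec ℕ k → Vec ℕ k → Set
[] <lex [] = ⊥
(x ∷ xs) <lex (y ∷ ys) = (x < y) ⊎ ((x ≡ y) × (xs <lex ys))

_<ω+1_ : Maybe ℕ → Maybe ℕ → Set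
just m <ω+1 just n = m < n
just m <ω+1 nothing = ⊤
nothing <ω+1 _ = ⊥

{-# OPTIONS --safe #-}
-- Measure an expression e by val e = 3 ^ ones e / eval e ³, that is 3 to the power of its defect, so
-- that adding 1 to a defect is multiplying by 3.  Let P be the set of all these values.  The values
-- of e · 3ʲ + 1 increase to 3 · val e as j grows, so every element of 3P is a limit of P from below.
-- Conversely P has no other limit points: bounded pieces of P are compact, by induction on the
-- bound in factors of 9/8.  Indeed val e = 1 or val e ≥ 9/8, so a product of two nontrivial factors
-- splits into smaller pieces, and for b ≤ a one has val (a + b) ≥ 9/8 · val a, bar tiny cases, with
-- finitely many possible b.
--
-- Compactness makes the least element of P above a given rational computable.  Iterating this
-- successor from y runs through a sequence of type ω cofinal in the next element of 3P; after
-- rescaling by 3ⁱ the elements of 3ⁱP between consecutive elements of 3ⁱ⁺¹P also have type ω.  So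
-- nesting gives type ωᵏ below the first element of 3ᵏP above 1, which is 3ᵏ.  An element of P
-- outside 3P is the value of an optimal expression, hence a defect; whether an element of 3P is
-- one is decided by a finite search.
module Submission where

open import Defs
import Data.Integer as ℤ
import Data.Integer.Properties as ℤ
open import Data.List using (List; []; _∷_; _++_; cartesianProductWith)
open import Data.List.Membership.Propositional using (_∈_; find; lose)
open import Data.List.Membership.Propositional.Properties
  using (∈-++⁺ˡ; ∈-++⁺ʳ; ∈-cartesianProductWith⁺)
open import Data.List.Relation.Unary.Any as Any using (Any; here; there; any?)
open import Data.List.Relation.Unary.Any.Properties using (++⁺ˡ; ++⁺ʳ)
open import Data.Maybe using (Maybe; just; nothing)
open import Data.Nat
open import Data.Nat.Coprimality as Coprime using (1-coprimeTo)
open import Data.Nat.Divisibility using (_∣_; divides)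
open import Data.Nat.Induction using (<-wellFounded)
open import Data.Nat.Primality using (Prime; prime?; euclidsLemma)
open import Data.Nat.Properties
open import Data.Nat.Tactic.RingSolver using (solve-∀)
open import Data.Product using (Σ; ∃; _×_; _,_; proj₁; proj₂)
open import Data.Rational as ℚ using (ℚ; mkℚ; 0ℚ; 1ℚ; 1/_)
  renaming (_≤_ to infix 4 _≼_; _<_ to infix 4 _≺_)
import Data.Rational.Properties as ℚ
open import Data.Rational.Unnormalised using (*≡*)
import Data.Rational.Unnormalised.Properties as ℚᵘ
open import Data.Sum using (_⊎_; inj₁; inj₂; [_,_]′)
open import Data.Unit using (⊤; tt)
open import Data.Vec using (Vec; []; _∷_)
open import Induction.WellFounded using (Acc; acc)
open import Relation.Binary.Definitions using (tri<; tri≈; tri>)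
open import Relation.Binary.PropositionalEquality
open import Relation.Nullary using (¬_; Dec; yes; no; contradiction; _×-dec_)
open import Relation.Nullary.Decidable using (from-yes)

-- The gap between the values 1 and 9/8

1≤ones : ∀ e → 1 ≤ ones e
1≤ones one = s≤s z≤n
1≤ones (a ⊕ b) = ≤-trans (1≤ones a) (m≤m+n _ _)
1≤ones (a ⊗ b) = ≤-trans (1≤ones a) (m≤m+n _ _)

one-or-2≤ones : ∀ e → e ≡ one ⊎ 2 ≤ ones e
one-or-2≤ones one = inj₁ refl
one-or-2≤ones (a ⊕ b) = inj₂ (+-mono-≤ (1≤ones a) (1≤ones b))
one-or-2≤ones (a ⊗ b) = inj₂ (+-mono-≤ (1≤ones a) (1≤ones b))

1≤eval : ∀ e → 1 ≤ eval e
1≤eval one = s≤s z≤n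
1≤eval (a ⊕ b) = ≤-trans (1≤eval a) (m≤m+n _ _)
1≤eval (a ⊗ b) = *-mono-≤ (1≤eval a) (1≤eval b)

cube-mono-≤ : ∀ {m n} → m ≤ n → cube m ≤ cube n
cube-mono-≤ p = *-mono-≤ (*-mono-≤ p p) p

cube-mono-< : ∀ {m n} → m < n → cube m < cube n
cube-mono-< p = *-mono-< (*-mono-< p p) p

cube-* : ∀ m n → cube (m * n) ≡ cube m * cube n
cube-* = ring
  where
  ring : ∀ m n → (m * n) * (m * n) * (m * n) ≡ (m * m * m) * (n * n * n)
  ring = solve-∀

1≤cube : ∀ e → 1 ≤ cube (eval e)
1≤cube e = cube-mono-≤ (1≤eval e)

n<3^n : ∀ n → n < 3 ^ n
n<3^n zero = s≤s z≤n
n<3^n (suc n) = begin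
  2 + n               ≤⟨ m≤m+n (2 + n) (1 + (n + n)) ⟩
  2 + n + (1 + (n + n)) ≡⟨ ring n ⟩
  3 * suc n           ≤⟨ *-monoʳ-≤ 3 (n<3^n n) ⟩
  3 * 3 ^ n           ∎
  where
  open ≤-Reasoning
  ring : ∀ n → 2 + n + (1 + (n + n)) ≡ 3 * suc n
  ring = solve-∀

1≤3^ : ∀ n → 1 ≤ 3 ^ n
1≤3^ n = m^n>0 3 n

-- When `b` costs at least two ones, the weight grows by a factor of at least 9 and the cube, as
-- `eval b ≤ eval a`, by at most 8. A single one gives 3 against (4/3)³ = 64/27, and 81/64 exceeds
-- 9/8.
summand-drop : ∀ a b → eval b ≤ eval a → 2 ≤ ones b ⊎ 3 ≤ eval a →
  9 * cube (eval a + eval b) ≤ 8 * (3 ^ ones b * cube (eval a))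
summand-drop a b b≤a (inj₁ 2≤b) = begin
  9 * cube (A + eval b)        ≤⟨ *-monoʳ-≤ 9 (cube-mono-≤ (+-monoʳ-≤ A b≤a)) ⟩
  9 * cube (A + A)             ≡⟨ ring A ⟩
  8 * (3 ^ 2 * cube A)         ≤⟨ *-monoʳ-≤ 8 (*-monoˡ-≤ (cube A) (^-monoʳ-≤ 3 2≤b)) ⟩
  8 * (3 ^ ones b * cube A)    ∎
  where
  open ≤-Reasoning
  A = eval a
  ring : ∀ x → 9 * ((x + x) * (x + x) * (x + x)) ≡ 8 * (9 * (x * x * x))
  ring = solve-∀
summand-drop a b b≤a (inj₂ 3≤a) with one-or-2≤ones b
... | inj₂ 2≤b = summand-drop a b b≤a (inj₁ 2≤b)
-- Tripling turns (A + 1)/A ≤ 4/3 into an inequality between naturals.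
... | inj₁ refl = *-cancelˡ-≤ 3 (begin
  3 * (9 * cube (A + 1))      ≡⟨ ring₁ A ⟩
  cube (3 * A + 3)            ≤⟨ cube-mono-≤ (+-monoʳ-≤ (3 * A) 3≤a) ⟩
  cube (3 * A + A)            ≡⟨ ring₂ A ⟩
  64 * cube A                 ≤⟨ *-monoˡ-≤ (cube A) (m≤m+n 64 8) ⟩
  72 * cube A                 ≡⟨ ring₃ (cube A) ⟩
  3 * (8 * (3 ^ 1 * cube A))  ∎)
  where
  open ≤-Reasoning
  A = eval a
  ring₁ : ∀ x → 3 * (9 * ((x + 1) * (x + 1) * (x + 1))) ≡ (3 * x + 3) * (3 * x + 3) * (3 * x + 3)
  ring₁ = solve-∀
  ring₂ : ∀ x → (3 * x + x) * (3 * x + x) * (3 * x + x) ≡ 64 * (x * x * x)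
  ring₂ = solve-∀
  ring₃ : ∀ y → 72 * y ≡ 3 * (8 * (3 * y))
  ring₃ = solve-∀

Gap : Expr → Set
Gap e = cube (eval e) ≡ 3 ^ ones e ⊎ 9 * cube (eval e) ≤ 8 * 3 ^ ones e

gap⇒cube≤3^ : ∀ e → Gap e → cube (eval e) ≤ 3 ^ ones e
gap⇒cube≤3^ e (inj₁ p) = ≤-reflexive p
gap⇒cube≤3^ e (inj₂ p) = *-cancelˡ-≤ 8 (≤-trans (*-monoˡ-≤ (cube (eval e)) (m≤m+n 8 1)) p)

gap-⊕ : ∀ a b → Gap a → eval b ≤ eval a → Gap (a ⊕ b)
gap-⊕ a b ga b≤a = cases (one-or-2≤ones b) (3 ≤? eval a)
  where
  dropped : 2 ≤ ones b ⊎ 3 ≤ eval a → Gap (a ⊕ b)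
  dropped h = inj₂ (begin
    9 * cube (eval a + eval b)            ≤⟨ summand-drop a b b≤a h ⟩
    8 * (3 ^ ones b * cube (eval a))      ≤⟨ *-monoʳ-≤ 8 (*-monoʳ-≤ (3 ^ ones b) (gap⇒cube≤3^ a ga)) ⟩
    8 * (3 ^ ones b * 3 ^ ones a)         ≡⟨ cong (8 *_) (*-comm (3 ^ ones b) (3 ^ ones a)) ⟩
    8 * (3 ^ ones a * 3 ^ ones b)         ≡⟨ cong (8 *_) (^-distribˡ-+-* 3 (ones a) (ones b)) ⟨
    8 * 3 ^ (ones a + ones b)             ∎)
    where open ≤-Reasoning

  -- What `summand-drop` leaves out: adding a single one to 1 or 2. Value 1 occurs only for 2 + 1
  -- written with three ones; a costlier 2 gives 9 · 27 = 243 against at least 8 · 3⁴ = 648.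
  tiny : ∀ n c → n ≤ 2 → 1 ≤ n → 1 ≤ c → n ≡ 1 ⊎ 2 ≤ c →
    cube (n + 1) ≡ 3 ^ (c + 1) ⊎ 9 * cube (n + 1) ≤ 8 * 3 ^ (c + 1)
  tiny 1 c _ _ 1≤c _ = inj₂ (*-monoʳ-≤ 8 (^-monoʳ-≤ 3 (+-monoˡ-≤ 1 1≤c)))
  tiny 2 2 _ _ _ _ = inj₁ refl
  tiny 2 (suc (suc (suc c))) _ _ _ _ =
    inj₂ (≤-trans (m≤m+n 243 405) (*-monoʳ-≤ 8 (^-monoʳ-≤ 3 (+-monoˡ-≤ 1 (s≤s (s≤s (s≤s (z≤n {c}))))))))
  tiny 2 1 _ _ _ (inj₂ (s≤s ()))
  tiny (suc (suc (suc n))) c (s≤s (s≤s ())) _ _ _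

  cases : b ≡ one ⊎ 2 ≤ ones b → _ → Gap (a ⊕ b)
  cases (inj₂ p) _ = dropped (inj₁ p)
  cases (inj₁ _) (yes p) = dropped (inj₂ p)
  cases (inj₁ refl) (no p) = tiny (eval a) (ones a) (≤-pred (≰⇒> p)) (1≤eval a) (1≤ones a)
    ([ (λ { refl → inj₁ refl }) , inj₂ ]′ (one-or-2≤ones a))

gap : ∀ e → Gap e
gap one = inj₂ (m≤m+n 9 15)
gap (a ⊕ b) with ≤-total (eval b) (eval a)
... | inj₁ b≤a = gap-⊕ a b (gap a) b≤a
... | inj₂ a≤b = subst₂ (λ n c → cube n ≡ 3 ^ c ⊎ 9 * cube n ≤ 8 * 3 ^ c)
  (+-comm (eval b) (eval a)) (+-comm (ones b) (ones a)) (gap-⊕ b a (gap b) a≤b)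
gap (a ⊗ b) = subst₂ (λ n c → n ≡ c ⊎ 9 * n ≤ 8 * c)
  (sym (cube-* (eval a) (eval b))) (sym (^-distribˡ-+-* 3 (ones a) (ones b))) (product (gap a) (gap b))
  where
  open ≤-Reasoning
  product : Gap a → Gap b → cube (eval a) * cube (eval b) ≡ 3 ^ ones a * 3 ^ ones b
    ⊎ 9 * (cube (eval a) * cube (eval b)) ≤ 8 * (3 ^ ones a * 3 ^ ones b)
  product (inj₁ p) (inj₁ q) = inj₁ (cong₂ _*_ p q)
  product (inj₂ p) _ = inj₂ (begin
    9 * (cube (eval a) * cube (eval b)) ≡⟨ *-assoc 9 (cube (eval a)) _ ⟨
    9 * cube (eval a) * cube (eval b)   ≤⟨ *-mono-≤ p (gap⇒cube≤3^ b (gap b)) ⟩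
    8 * 3 ^ ones a * 3 ^ ones b         ≡⟨ *-assoc 8 (3 ^ ones a) _ ⟩
    8 * (3 ^ ones a * 3 ^ ones b)       ∎)
  product (inj₁ p) (inj₂ q) = inj₂ (begin
    9 * (cube (eval a) * cube (eval b)) ≡⟨ ring 9 (cube (eval a)) _ ⟩
    cube (eval a) * (9 * cube (eval b)) ≤⟨ *-mono-≤ (≤-reflexive p) q ⟩
    3 ^ ones a * (8 * 3 ^ ones b)       ≡⟨ ring 8 (3 ^ ones a) _ ⟨
    8 * (3 ^ ones a * 3 ^ ones b)       ∎)
    where
    ring : ∀ k x y → k * (x * y) ≡ x * (k * y)
    ring = solve-∀

cube≤3^ones : ∀ e → cube (eval e) ≤ 3 ^ ones e
cube≤3^ones e = gap⇒cube≤3^ e (gap e)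

-- For B ≤ A the increment (A + B)³ - A³ is at most 7A²B, hence A³ ≤ 7MA²B. For A ≤ B the summand B
-- alone suffices.
growth-bound : ∀ M A B → 1 ≤ A → suc M * cube A ≤ M * cube (A + B) → A ≤ M * (7 * B) + B
growth-bound M A B 1≤A h with ≤-total A B
... | inj₁ A≤B = ≤-trans A≤B (m≤n+m B _)
... | inj₂ B≤A = ≤-trans (*-cancelʳ-≤ A (M * (7 * B)) (A * A) {{>-nonZero (*-mono-≤ 1≤A 1≤A)}}
    (+-cancelˡ-≤ (M * cube A) _ _ main)) (m≤m+n _ B)
  where
  open ≤-Reasoning
  ring₁ : ∀ m a → m * (a * a * a) + a * (a * a) ≡ suc m * (a * a * a)
  ring₁ = solve-∀
  ring₂ : ∀ m a b → m * ((a + b) * (a + b) * (a + b))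
    ≡ m * (a * a * a) + m * (3 * (a * a * b) + 3 * (a * b * b) + b * b * b)
  ring₂ = solve-∀
  ring₃ : ∀ m a b → m * (3 * (a * a * b) + 3 * (a * a * b) + a * a * b) ≡ m * (7 * b) * (a * a)
  ring₃ = solve-∀
  main : M * cube A + A * (A * A) ≤ M * cube A + M * (7 * B) * (A * A)
  main = begin
    M * cube A + A * (A * A)  ≡⟨ ring₁ M A ⟩
    suc M * cube A            ≤⟨ h ⟩
    M * cube (A + B)          ≡⟨ ring₂ M A B ⟩
    M * cube A + M * (3 * (A * A * B) + 3 * (A * B * B) + B * B * B)
      ≤⟨ +-monoʳ-≤ (M * cube A) (*-monoʳ-≤ M (+-mono-≤ (+-monoʳ-≤ (3 * (A * A * B))
           (*-monoʳ-≤ 3 (*-monoˡ-≤ B (*-monoʳ-≤ A B≤A)))) (*-monoˡ-≤ B (*-mono-≤ B≤A B≤A)))) ⟩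
    M * cube A + M * (3 * (A * A * B) + 3 * (A * A * B) + A * A * B)
      ≡⟨ cong (M * cube A +_) (ring₃ M A B) ⟩
    M * cube A + M * (7 * B) * (A * A) ∎

-- Optimal expressions

-- Here `n` limits the nesting depth, which never exceeds the number of ones when `one` has depth 1.
-- So the list is finite and contains every expression with at most `n` ones, among others.
exprs : ℕ → List Expr
exprs zero = []
exprs (suc n) = one ∷ cartesianProductWith _⊕_ (exprs n) (exprs n)
                   ++ cartesianProductWith _⊗_ (exprs n) (exprs n)

private
  both< : ∀ a b {n} → ones a + ones b ≤ suc n → ones a ≤ n × ones b ≤ n
  both< a b h =
    ≤-pred (≤-trans (≤-trans (≤-reflexive (+-comm 1 (ones a))) (+-monoʳ-≤ (ones a) (1≤ones b))) h) ,
    ≤-pred (≤-trans (+-monoˡ-≤ (ones b) (1≤ones a)) h)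

∈-exprs : ∀ n e → ones e ≤ n → e ∈ exprs n
∈-exprs zero e h = contradiction (≤-trans (1≤ones e) h) λ ()
∈-exprs (suc n) one h = here refl
∈-exprs (suc n) (a ⊕ b) h with both< a b h
... | p , q = there (∈-++⁺ˡ (∈-cartesianProductWith⁺ _⊕_ (∈-exprs n a p) (∈-exprs n b q)))
∈-exprs (suc n) (a ⊗ b) h with both< a b h
... | p , q = there (∈-++⁺ʳ (cartesianProductWith _⊕_ (exprs n) (exprs n))
  (∈-cartesianProductWith⁺ _⊗_ (∈-exprs n a p) (∈-exprs n b q)))

Optimal : Expr → Set
Optimal e = ∀ e′ → eval e′ ≡ eval e → ones e ≤ ones e′

improve : ∀ e → (∃ λ e′ → eval e′ ≡ eval e × ones e′ < ones e) ⊎ Optimal e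
improve e with any? (λ e′ → (eval e′ ≟ eval e) ×-dec (ones e′ <? ones e)) (exprs (ones e))
... | yes p = let e′ , _ , q = find p in inj₁ (e′ , q)
... | no ¬p = inj₂ λ e′ eq → ≮⇒≥ λ lt → ¬p (lose (∈-exprs (ones e) e′ (<⇒≤ lt)) (eq , lt))

optimal? : ∀ e → Dec (Optimal e)
optimal? e with improve e
... | inj₁ (e′ , eq , lt) = no λ opt → <⇒≱ lt (opt e′ eq)
... | inj₂ opt = yes opt

cube-injective : ∀ {m n} → cube m ≡ cube n → m ≡ n
cube-injective {m} {n} eq with <-cmp m n
... | tri< p _ _ = contradiction eq (<⇒≢ (cube-mono-< p))
... | tri≈ _ p _ = p
... | tri> _ _ p = contradiction (sym eq) (<⇒≢ (cube-mono-< p))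

3∣cube⇒3∣ : ∀ n → 3 ∣ cube n → 3 ∣ n
3∣cube⇒3∣ n h = [ (λ h′ → [ (λ z → z) , (λ z → z) ]′ (euclidsLemma n n prime₃ h′)) , (λ z → z) ]′
  (euclidsLemma (n * n) n prime₃ h)
  where
  prime₃ : Prime 3
  prime₃ = from-yes (prime? 3)

n≡m*3⇒9cube : ∀ n m k → n ≡ m * 3 → cube n ≡ 3 * k → k ≡ 9 * cube m
n≡m*3⇒9cube _ m k refl eq = *-cancelˡ-≡ k (9 * cube m) 3 (trans (sym eq) (ring m))
  where
  ring : ∀ z → (z * 3) * (z * 3) * (z * 3) ≡ 3 * (9 * (z * z * z))
  ring = solve-∀

cube≡3*⇒ : ∀ n k → cube n ≡ 3 * k → ∃ λ m → n ≡ m * 3 × k ≡ 9 * cube m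
cube≡3*⇒ n k eq = third (3∣cube⇒3∣ n (divides k (trans eq (*-comm 3 k))))
  where
  third : 3 ∣ n → ∃ λ m → n ≡ m * 3 × k ≡ 9 * cube m
  third (divides m eqn) = m , eqn , n≡m*3⇒9cube n m k eqn eq

-- Infinite descent: 3 divides `x`, then `y`, and the quotients satisfy the same equation.
cube≢3cube : ∀ x y → 1 ≤ x → cube x ≢ 3 * cube y
cube≢3cube x y = go x y (<-wellFounded x)
  where
  shrink : ∀ m → 1 ≤ m * 3 → 1 ≤ m × m < m * 3
  shrink m@(suc _) _ = s≤s z≤n , m<m*n m 3 (s≤s (s≤s z≤n))
  go : ∀ x y → Acc _<_ x → 1 ≤ x → cube x ≢ 3 * cube y
  go x y (acc rs) 1≤x eq =
    let x′ , x≡ , eq₁ = cube≡3*⇒ x (cube y) eq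
        y′ , _ , eq₂ = cube≡3*⇒ y (3 * cube x′) (trans eq₁ (*-assoc 3 3 (cube x′)))
        1≤x′ , x′<x = shrink x′ (subst (1 ≤_) x≡ 1≤x)
    in go x′ y′ (rs (subst (x′ <_) (sym x≡) x′<x)) 1≤x′
         (*-cancelˡ-≡ (cube x′) (3 * cube y′) 3 (trans eq₂ (*-assoc 3 3 (cube y′))))

-- Subtracting 3 from `d` while tripling `y` reduces to the remainder modulo 3. Remainder 1 is
-- excluded by descent, and so is remainder 2 after `x` and `y` swap roles.
cube-ratio : ∀ d x y → 1 ≤ x → 1 ≤ y → cube x ≡ 3 ^ d * cube y → ∃ λ j → d ≡ j * 3 × x ≡ y * 3 ^ j
cube-ratio 0 x y _ _ eq = 0 , refl , trans (cube-injective (trans eq (*-identityˡ _))) (sym (*-identityʳ y))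
cube-ratio 1 x y 1≤x _ eq = contradiction eq (cube≢3cube x y 1≤x)
cube-ratio 2 x y _ 1≤y eq =
  let x′ , _ , eq′ = cube≡3*⇒ x (3 * cube y) (trans eq (*-assoc 3 3 (cube y)))
  in contradiction (*-cancelˡ-≡ (cube y) (3 * cube x′) 3 (trans eq′ (*-assoc 3 3 (cube x′))))
       (cube≢3cube y x′ 1≤y)
cube-ratio (suc (suc (suc d))) x y 1≤x 1≤y eq =
  let j , eqd , eqx = cube-ratio d x (y * 3) 1≤x (≤-trans 1≤y (m≤m*n y 3)) (trans eq (ring (3 ^ d) y))
  in suc j , cong (3 +_) eqd , trans eqx (*-assoc y 3 (3 ^ j))
  where
  ring : ∀ p z → 3 * (3 * (3 * p)) * (z * z * z) ≡ p * ((z * 3) * (z * 3) * (z * 3))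
  ring = solve-∀

three : Expr
three = (one ⊕ one) ⊕ one

-- Tripling the number for three more ones preserves 3 ^ `ones` / `eval`³, so every value is shared
-- by arbitrarily large numbers.
scale : ℕ → Expr → Expr
scale zero e = e
scale (suc j) e = scale j e ⊗ three

eval-scale : ∀ j e → eval (scale j e) ≡ eval e * 3 ^ j
eval-scale zero e = sym (*-identityʳ _)
eval-scale (suc j) e = trans (cong (_* 3) (eval-scale j e)) (ring (eval e) (3 ^ j))
  where
  ring : ∀ x y → x * y * 3 ≡ x * (3 * y)
  ring = solve-∀

ones-scale : ∀ j e → ones (scale j e) ≡ ones e + j * 3
ones-scale zero e = sym (+-identityʳ _)
ones-scale (suc j) e = trans (cong (_+ 3) (ones-scale j e)) (ring (ones e) (j * 3))
  where
  ring : ∀ x y → x + y + 3 ≡ x + (3 + y)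
  ring = solve-∀

-- Otherwise q times a power of 3 would beat e, because 3 has no rational cube root.
optimal⇒ones≤ : ∀ e q → Optimal e →
  3 ^ ones e * cube (eval q) ≡ 3 * 3 ^ ones q * cube (eval e) → ones e ≤ ones q
optimal⇒ones≤ e q opt eq = ≮⇒≥ λ lt → beat lt (m≤n⇒∃[o]m+o≡n lt)
  where
  ring : ∀ p x y → p * x * y ≡ p * (x * y)
  ring = solve-∀
  beat : ones q < ones e → ¬ ∃ λ d → suc (ones q) + d ≡ ones e
  beat lt (d , eqd) =
    let j , d≡ , n≡ = cube-ratio d (eval e) (eval q) (1≤eval e) (1≤eval q) ratio
    in <⇒≱ (≤-reflexive (trans (cong suc (trans (ones-scale j q) (cong (ones q +_) (sym d≡)))) eqd))
         (opt (scale j q) (trans (eval-scale j q) (sym n≡)))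
    where
    open ≡-Reasoning
    ratio : cube (eval e) ≡ 3 ^ d * cube (eval q)
    ratio = sym (*-cancelˡ-≡ _ _ (3 ^ suc (ones q)) {{m^n≢0 3 (suc (ones q))}} (begin
      3 ^ suc (ones q) * (3 ^ d * cube (eval q)) ≡⟨ ring (3 ^ suc (ones q)) (3 ^ d) _ ⟨
      3 ^ suc (ones q) * 3 ^ d * cube (eval q)   ≡⟨ cong (_* cube (eval q)) (^-distribˡ-+-* 3 (suc (ones q)) d) ⟨
      3 ^ (suc (ones q) + d) * cube (eval q)     ≡⟨ cong (λ c → 3 ^ c * cube (eval q)) eqd ⟩
      3 ^ ones e * cube (eval q)                 ≡⟨ eq ⟩
      3 ^ suc (ones q) * cube (eval e)           ∎))

-- Rationals and values of expressions

-- Kept opaque: unfolding rational multiplication exposes its normalisation by gcds.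
opaque
  infixl 7 _·_
  _·_ : ℚ → ℚ → ℚ
  _·_ = ℚ._*_

  ·-monoʳ-≼ : ∀ {r x y} → 0ℚ ≺ r → x ≼ y → r · x ≼ r · y
  ·-monoʳ-≼ {r} 0≺r = ℚ.*-monoˡ-≤-nonNeg r {{ℚ.nonNegative (ℚ.<⇒≤ 0≺r)}}

  ·-monoˡ-≼ : ∀ {r x y} → 0ℚ ≺ r → x ≼ y → x · r ≼ y · r
  ·-monoˡ-≼ {r} 0≺r = ℚ.*-monoʳ-≤-nonNeg r {{ℚ.nonNegative (ℚ.<⇒≤ 0≺r)}}

  ·-monoʳ-≺ : ∀ {r x y} → 0ℚ ≺ r → x ≺ y → r · x ≺ r · y
  ·-monoʳ-≺ {r} 0≺r = ℚ.*-monoʳ-<-pos r {{ℚ.positive 0≺r}}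

  ·-monoˡ-≺ : ∀ {r x y} → 0ℚ ≺ r → x ≺ y → x · r ≺ y · r
  ·-monoˡ-≺ {r} 0≺r = ℚ.*-monoˡ-<-pos r {{ℚ.positive 0≺r}}

  ·-cancelʳ-≼ : ∀ {r x y} → 0ℚ ≺ r → x · r ≼ y · r → x ≼ y
  ·-cancelʳ-≼ {r} 0≺r = ℚ.*-cancelʳ-≤-pos r {{ℚ.positive 0≺r}}

  ·-cancelʳ-≺ : ∀ {r x y} → 0ℚ ≺ r → x · r ≺ y · r → x ≺ y
  ·-cancelʳ-≺ {r} 0≺r = ℚ.*-cancelʳ-<-nonNeg r {{ℚ.nonNegative (ℚ.<⇒≤ 0≺r)}}

  ·-cancelˡ-≼ : ∀ {r x y} → 0ℚ ≺ r → r · x ≼ r · y → x ≼ y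
  ·-cancelˡ-≼ {r} 0≺r = ℚ.*-cancelˡ-≤-pos r {{ℚ.positive 0≺r}}

  ·-cancelˡ-≺ : ∀ {r x y} → 0ℚ ≺ r → r · x ≺ r · y → x ≺ y
  ·-cancelˡ-≺ {r} 0≺r = ℚ.*-cancelˡ-<-nonNeg r {{ℚ.nonNegative (ℚ.<⇒≤ 0≺r)}}

  ι : ℕ → ℚ
  ι n = mkℚ (ℤ.+ n) 0 (Coprime.sym (1-coprimeTo n))

  ·-assoc : ∀ x y z → x · y · z ≡ x · (y · z)
  ·-assoc = ℚ.*-assoc

  ·-comm : ∀ x y → x · y ≡ y · x
  ·-comm = ℚ.*-comm

  ι1≡1 : ι 1 ≡ 1ℚ
  ι1≡1 = ℚ.toℚᵘ-injective (*≡* refl)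

  ·-identityˡ : ∀ x → ι 1 · x ≡ x
  ·-identityˡ x = subst (λ u → u · x ≡ x) (sym ι1≡1) (ℚ.*-identityˡ x)

  inverse : ∀ {x} → 0ℚ ≺ x → ∃ λ y → y · x ≡ ι 1
  inverse {x} 0≺x = 1/ x , trans (ℚ.*-inverseˡ x) (sym ι1≡1)
    where
    instance
      x≢0 : ℚ.NonZero x
      x≢0 = ℚ.pos⇒nonZero x {{ℚ.positive 0≺x}}

  ι-mono-≤ : ∀ {m n} → m ≤ n → ι m ≼ ι n
  ι-mono-≤ p = ℚ.*≤* (ℤ.*-monoʳ-≤-nonNeg (ℤ.+ 1) (ℤ.+≤+ p))

  ι-mono-< : ∀ {m n} → m < n → ι m ≺ ι n
  ι-mono-< p = ℚ.*<* (ℤ.*-monoʳ-<-pos (ℤ.+ 1) (ℤ.+<+ p))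

  ι0≡0 : ι 0 ≡ 0ℚ
  ι0≡0 = ℚ.toℚᵘ-injective (*≡* refl)

  ι-* : ∀ m n → ι (m * n) ≡ ι m · ι n
  ι-* m n = sym (ℚ.toℚᵘ-injective (ℚᵘ.≃-trans (ℚ.toℚᵘ-homo-* (ι m) (ι n))
    (*≡* (cong (ℤ._* (ℤ.+ 1)) (sym (ℤ.pos-* m n))))))

  fraction : ∀ x → 0ℚ ≺ x → ∃ λ p → ∃ λ q → 1 ≤ q × x · ι q ≡ ι p
  fraction x@(mkℚ (ℤ.+ p) d _) _ = p , suc d , s≤s z≤n ,
    ℚ.toℚᵘ-injective (ℚᵘ.≃-trans (ℚ.toℚᵘ-homo-* x (ι (suc d)))
      (*≡* (ℤ.*-assoc (ℤ.+ p) (ℤ.+ suc d) (ℤ.+ 1))))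
  fraction (mkℚ ℤ.-[1+ n ] d _) (ℚ.*<* ())

·-identityʳ : ∀ x → x · ι 1 ≡ x
·-identityʳ x = trans (·-comm x (ι 1)) (·-identityˡ x)

x∙yz≡y∙xz : ∀ x y z → x · (y · z) ≡ y · (x · z)
x∙yz≡y∙xz x y z = trans (sym (·-assoc x y z)) (trans (cong (_· z) (·-comm x y)) (·-assoc y x z))

xy∙zw≡xz∙yw : ∀ x y z w → x · y · (z · w) ≡ x · z · (y · w)
xy∙zw≡xz∙yw x y z w = trans (·-assoc x y (z · w))
  (trans (cong (x ·_) (x∙yz≡y∙xz y z w)) (sym (·-assoc x z (y · w))))

≺⇒⋡ : ∀ {x y} → x ≺ y → ¬ y ≼ x
≺⇒⋡ p q = ℚ.<-irrefl refl (ℚ.<-≤-trans p q)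

opaque
  ≺-or-≽ : ∀ x y → x ≺ y ⊎ y ≼ x
  ≺-or-≽ x y with ℚ.<-cmp x y
  ... | tri< p _ _ = inj₁ p
  ... | tri≈ _ refl _ = inj₂ ℚ.≤-refl
  ... | tri> _ _ p = inj₂ (ℚ.<⇒≤ p)

ι-cancel-≤ : ∀ {m n} → ι m ≼ ι n → m ≤ n
ι-cancel-≤ p = ≮⇒≥ λ lt → ≺⇒⋡ (ι-mono-< lt) p

0≺ι : ∀ {n} → 1 ≤ n → 0ℚ ≺ ι n
0≺ι {n} p = subst (_≺ ι n) ι0≡0 (ι-mono-< p)

-- The fraction need not be in lowest terms, so values and their products are compared by
-- cross-multiplication in ℕ.
record IsFrac (x : ℚ) (n d : ℕ) : Set where
  constructor isFrac
  field
    1≤den : 1 ≤ d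
    ·den≡num : x · ι d ≡ ι n

ι-isFrac : ∀ n → IsFrac (ι n) n 1
ι-isFrac n = isFrac ≤-refl (·-identityʳ (ι n))

private
  cross : ∀ {x n d} → IsFrac x n d → ∀ e → x · ι (d * e) ≡ ι (n * e)
  cross {x} {n} {d} (isFrac _ eq) e = begin
    x · ι (d * e)     ≡⟨ cong (x ·_) (ι-* d e) ⟩
    x · (ι d · ι e)   ≡⟨ ·-assoc x (ι d) (ι e) ⟨
    x · ι d · ι e     ≡⟨ cong (_· ι e) eq ⟩
    ι n · ι e         ≡⟨ ι-* n e ⟨
    ι (n * e)         ∎
    where open ≡-Reasoning

frac-· : ∀ {x n d y m e} → IsFrac x n d → IsFrac y m e → IsFrac (x · y) (n * m) (d * e)
frac-· {x} {n} {d} {y} {m} {e} (isFrac 1≤d p) (isFrac 1≤e q) = isFrac (*-mono-≤ 1≤d 1≤e) (begin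
  x · y · ι (d * e)      ≡⟨ cong (x · y ·_) (ι-* d e) ⟩
  x · y · (ι d · ι e)    ≡⟨ xy∙zw≡xz∙yw x y (ι d) (ι e) ⟩
  x · ι d · (y · ι e)    ≡⟨ cong₂ _·_ p q ⟩
  ι n · ι m              ≡⟨ ι-* n m ⟨
  ι (n * m)              ∎)
  where open ≡-Reasoning

frac-≤⁺ : ∀ {x n d y m e} → IsFrac x n d → IsFrac y m e → n * e ≤ m * d → x ≼ y
frac-≤⁺ {d = d} {y} {m} {e} p@(isFrac 1≤d _) q@(isFrac 1≤e _) h = ·-cancelʳ-≼ (0≺ι (*-mono-≤ 1≤d 1≤e))
  (subst₂ _≼_ (sym (cross p e)) (trans (sym (cross q d)) (cong (λ k → y · ι k) (*-comm e d))) (ι-mono-≤ h))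

frac-≤⁻ : ∀ {x n d y m e} → IsFrac x n d → IsFrac y m e → x ≼ y → n * e ≤ m * d
frac-≤⁻ {d = d} {y} {m} {e} p@(isFrac 1≤d _) q@(isFrac 1≤e _) h = ι-cancel-≤
  (subst₂ _≼_ (cross p e) (trans (cong (λ k → y · ι k) (*-comm d e)) (cross q d))
    (·-monoˡ-≼ (0≺ι (*-mono-≤ 1≤d 1≤e)) h))

frac-<⁻ : ∀ {x n d y m e} → IsFrac x n d → IsFrac y m e → x ≺ y → n * e < m * d
frac-<⁻ p q h = ≰⇒> λ k → ≺⇒⋡ h (frac-≤⁺ q p k)

frac-<⁺ : ∀ {x n d y m e} → IsFrac x n d → IsFrac y m e → n * e < m * d → x ≺ y
frac-<⁺ {x} {y = y} p q h with ≺-or-≽ x y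
... | inj₁ k = k
... | inj₂ k = contradiction (frac-≤⁻ q p k) (<⇒≱ h)

frac-≡⁺ : ∀ {x n d y m e} → IsFrac x n d → IsFrac y m e → n * e ≡ m * d → x ≡ y
frac-≡⁺ p q h = ℚ.≤-antisym (frac-≤⁺ p q (≤-reflexive h)) (frac-≤⁺ q p (≤-reflexive (sym h)))

≼ι : ∀ x → ∃ λ k → x ≼ ι k
≼ι x with ≺-or-≽ 0ℚ x
... | inj₂ h = 0 , subst (x ≼_) (sym ι0≡0) h
... | inj₁ h with fraction x h
... | p , q , 1≤q , eq = p , frac-≤⁺ (isFrac 1≤q eq) (ι-isFrac p) (*-monoʳ-≤ p 1≤q)

quotient : ∀ n d → 1 ≤ d → ∃ λ x → IsFrac x n d
quotient n d 1≤d = let d⁻¹ , eq = inverse (0≺ι 1≤d) in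
  ι n · d⁻¹ , isFrac 1≤d (trans (·-assoc (ι n) d⁻¹ (ι d)) (trans (cong (ι n ·_) eq) (·-identityʳ (ι n))))

opaque
  val : Expr → ℚ
  val e = proj₁ (quotient (3 ^ ones e) (cube (eval e)) (1≤cube e))

  val-isFrac : ∀ e → IsFrac (val e) (3 ^ ones e) (cube (eval e))
  val-isFrac e = proj₂ (quotient (3 ^ ones e) (cube (eval e)) (1≤cube e))

1≼val : ∀ e → ι 1 ≼ val e
1≼val e = frac-≤⁺ (ι-isFrac 1) (val-isFrac e)
  (subst₂ _≤_ (sym (*-identityˡ _)) (sym (*-identityʳ _)) (cube≤3^ones e))

0≺val : ∀ e → 0ℚ ≺ val e
0≺val e = ℚ.<-≤-trans (0≺ι ≤-refl) (1≼val e)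

val-⊗ : ∀ a b → val (a ⊗ b) ≡ val a · val b
val-⊗ a b = frac-≡⁺ (val-isFrac (a ⊗ b)) (frac-· (val-isFrac a) (val-isFrac b))
  (cong₂ _*_ (^-distribˡ-+-* 3 (ones a) (ones b)) (sym (cube-* (eval a) (eval b))))

val-one : val one ≡ ι 3
val-one = frac-≡⁺ (val-isFrac one) (ι-isFrac 3) refl

val-three : val three ≡ ι 1
val-three = frac-≡⁺ (val-isFrac three) (ι-isFrac 1) refl

val-scale : ∀ j e → val (scale j e) ≡ val e
val-scale zero e = refl
val-scale (suc j) e = begin
  val (scale j e ⊗ three)       ≡⟨ val-⊗ (scale j e) three ⟩
  val (scale j e) · val three   ≡⟨ cong₂ _·_ (val-scale j e) val-three ⟩
  val e · ι 1                   ≡⟨ ·-identityʳ (val e) ⟩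
  val e                         ∎
  where open ≡-Reasoning

private
  swap : ∀ u v x → u * v * x ≡ u * x * v
  swap = solve-∀

  swap-1 : ∀ u v q c → u * v * q * c ≡ u * v * (c * 1) * q
  swap-1 = solve-∀

-- As val (a ⊕ b) = val a · 3 ^ ones b · (1 + eval b / eval a) ⁻³, staying away from the
-- supremum bounds eval a.
⊕-bounded : ∀ b y z → 0ℚ ≺ y → z ≺ y · ι (3 ^ ones b) →
  ∃ λ c → ∀ a → y ≼ val a → val (a ⊕ b) ≼ z → ones (a ⊕ b) ≤ c
⊕-bounded b y z 0≺y z≺ with ≺-or-≽ 0ℚ z
... | inj₂ z≼0 = 0 , λ a _ h → contradiction (ℚ.≤-trans h z≼0) (≺⇒⋡ (0≺val (a ⊕ b)))
... | inj₁ 0≺z with fraction z 0≺z | fraction y 0≺y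
... | p , q , 1≤q , eqz | p′ , q′ , 1≤q′ , eqy = p * cube (p * (q′ * 1) * (7 * eval b) + eval b + eval b) , bound
  where
  open ≤-Reasoning
  B = eval b
  w = p * (q′ * 1)
  fz : IsFrac z p q
  fz = isFrac 1≤q eqz
  fw : IsFrac (y · ι (3 ^ ones b)) (p′ * 3 ^ ones b) (q′ * 1)
  fw = frac-· (isFrac {x = y} 1≤q′ eqy) (ι-isFrac (3 ^ ones b))
  bound : ∀ a → y ≼ val a → val (a ⊕ b) ≼ z → ones (a ⊕ b) ≤ p * cube (w * (7 * B) + B + B)
  bound a y≼ ≼z = begin
    ones (a ⊕ b)                     ≤⟨ <⇒≤ (n<3^n _) ⟩
    3 ^ ones (a ⊕ b)                 ≤⟨ m≤m*n _ q {{>-nonZero 1≤q}} ⟩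
    3 ^ ones (a ⊕ b) * q             ≤⟨ value ⟩
    p * cube (eval a + B)            ≤⟨ *-monoʳ-≤ p (cube-mono-≤ (+-monoˡ-≤ B (growth-bound w (eval a) B (1≤eval a) growth))) ⟩
    p * cube (w * (7 * B) + B + B)   ∎
    where
    A³ = cube (eval a)
    value : 3 ^ ones (a ⊕ b) * q ≤ p * cube (eval a + B)
    value = frac-≤⁻ (val-isFrac (a ⊕ b)) fz ≼z
    weight : p′ * 3 ^ ones b * (A³ * 1) ≤ 3 ^ ones a * 3 ^ ones b * (q′ * 1)
    weight = frac-≤⁻ fw (frac-· (val-isFrac a) (ι-isFrac (3 ^ ones b)))
      (·-monoˡ-≼ (0≺ι (1≤3^ (ones b))) y≼)
    growth : suc w * A³ ≤ w * cube (eval a + B)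
    growth = begin
      suc w * A³                                        ≤⟨ *-monoˡ-≤ A³ (frac-<⁻ fz fw z≺) ⟩
      p′ * 3 ^ ones b * q * A³                          ≡⟨ swap-1 p′ (3 ^ ones b) q A³ ⟩
      p′ * 3 ^ ones b * (A³ * 1) * q                    ≤⟨ *-monoˡ-≤ q weight ⟩
      3 ^ ones a * 3 ^ ones b * (q′ * 1) * q            ≡⟨ cong (λ k → k * (q′ * 1) * q) (^-distribˡ-+-* 3 (ones a) (ones b)) ⟨
      3 ^ ones (a ⊕ b) * (q′ * 1) * q                   ≡⟨ swap (3 ^ ones (a ⊕ b)) (q′ * 1) q ⟩
      3 ^ ones (a ⊕ b) * q * (q′ * 1)                   ≤⟨ *-monoˡ-≤ (q′ * 1) value ⟩
      p * cube (eval a + B) * (q′ * 1)                  ≡⟨ swap p _ (q′ * 1) ⟩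
      w * cube (eval a + B)                             ∎

val-⊕≺ : ∀ a b → val (a ⊕ b) ≺ val a · ι (3 ^ ones b)
val-⊕≺ a b = frac-<⁺ (val-isFrac (a ⊕ b)) (frac-· (val-isFrac a) (ι-isFrac (3 ^ ones b))) (begin-strict
  3 ^ (ones a + ones b) * (cube (eval a) * 1)
    ≡⟨ cong₂ _*_ (^-distribˡ-+-* 3 (ones a) (ones b)) (*-identityʳ (cube (eval a))) ⟩
  3 ^ ones a * 3 ^ ones b * cube (eval a)
    <⟨ *-monoʳ-< (3 ^ ones a * 3 ^ ones b) {{m*n≢0 _ _ {{m^n≢0 3 (ones a)}} {{m^n≢0 3 (ones b)}}}}
         (cube-mono-< (m<m+n (eval a) (1≤eval b))) ⟩
  3 ^ ones a * 3 ^ ones b * cube (eval a + eval b) ∎)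
  where open ≤-Reasoning

-- By `⊕-bounded`, sums a + 1 with `val a` at least `val e` and value at most `y` have at most `c`
-- ones. The witness e · 3ᶜ + 1 has more, so its value exceeds `y`.
approach : ∀ e y → y ≺ ι 3 · val e → ∃ λ p → y ≺ val p × val p ≺ ι 3 · val e
approach e y y≺ with ⊕-bounded one (val e) y (0≺val e) (subst (y ≺_) (·-comm (ι 3) (val e)) y≺)
... | c , bound = p , [ (λ h → h) , (λ h → contradiction h far) ]′ (≺-or-≽ y (val p)) ,
  subst (val p ≺_) (trans (·-comm _ (ι 3)) (cong (ι 3 ·_) (val-scale c e))) (val-⊕≺ (scale c e) one)
  where
  p = scale c e ⊕ one
  far : ¬ val p ≼ y
  far h = <⇒≱ (begin-strict
    c                        ≤⟨ m≤m*n c 3 ⟩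
    c * 3                    ≤⟨ m≤n+m (c * 3) (ones e) ⟩
    ones e + c * 3           ≡⟨ ones-scale c e ⟨
    ones (scale c e)         <⟨ m<m+n (ones (scale c e)) (s≤s z≤n) ⟩
    ones (scale c e) + 1     ∎)
    (bound (scale c e) (ℚ.≤-reflexive (sym (val-scale c e))) h)
    where open ≤-Reasoning

opaque
  -- Any `x′` strictly between max(z/y, 0) and `x` will do; the maximum keeps it positive when `z`
  -- is not.
  ≺·-split : ∀ {x y z} → 0ℚ ≺ x → 0ℚ ≺ y → z ≺ x · y → ∃ λ x′ → 0ℚ ≺ x′ × x′ ≺ x × z ≺ x′ · y
  ≺·-split {x} {y} {z} 0≺x 0≺y z≺ =
    let x′ , m≺x′ , x′≺x = ℚ.<-dense m≺x in
    x′ , ℚ.≤-<-trans (ℚ.p≤q⊔p r 0ℚ) m≺x′ , x′≺x ,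
    subst (_≺ x′ · y) r·y≡z (·-monoˡ-≺ 0≺y (ℚ.≤-<-trans (ℚ.p≤p⊔q r 0ℚ) m≺x′))
    where
    y⁻¹ : ℚ
    y⁻¹ = proj₁ (inverse 0≺y)
    r : ℚ
    r = z · y⁻¹
    r·y≡z : r · y ≡ z
    r·y≡z = trans (·-assoc z y⁻¹ y) (trans (cong (z ·_) (proj₂ (inverse 0≺y))) (·-identityʳ z))
    r≺x : r ≺ x
    r≺x = ·-cancelʳ-≺ 0≺y (subst (_≺ x · y) (sym r·y≡z) z≺)
    m≺x : r ℚ.⊔ 0ℚ ≺ x
    m≺x = [ (λ eq → subst (_≺ x) (sym eq) r≺x) , (λ eq → subst (_≺ x) (sym eq) 0≺x) ]′ (ℚ.⊔-sel r 0ℚ)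

  ≺·-split₂ : ∀ {x y z} → 0ℚ ≺ x → 0ℚ ≺ y → z ≺ x · y →
    ∃ λ x′ → ∃ λ y′ → 0ℚ ≺ x′ × x′ ≺ x × y′ ≺ y × z ≺ x′ · y′
  ≺·-split₂ {x} {y} {z} 0≺x 0≺y z≺ =
    let x′ , 0≺x′ , x′≺x , z≺′ = ≺·-split 0≺x 0≺y z≺
        y′ , _ , y′≺y , z≺″ = ≺·-split 0≺y 0≺x′ (subst (z ≺_) (·-comm x′ y) z≺′)
    in x′ , y′ , 0≺x′ , x′≺x , y′≺y , subst (z ≺_) (·-comm y′ x′) z≺″

-- Compactness of bounded sets of values

-- Constructive compactness: the values in S can accumulate only from below, and only at points 3 · val t.
data Cov : (Expr → Set) → Set₁ where
  empty  : ∀ {S} → (∀ {a} → ¬ S a) → Cov S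
  single : ∀ {S} t → (∀ {a} → S a → val a ≡ val t) → Cov S
  union  : ∀ {S T U} → Cov S → Cov T → (∀ {a} → U a → S a ⊎ T a) → Cov U
  limit  : ∀ {S} t → (∀ {a} → S a → val a ≼ ι 3 · val t) →
           (∀ z → z ≺ ι 3 · val t → Cov (λ a → S a × val a ≼ z)) → Cov S

_⊆ᵛ_ : (Expr → Set) → (Expr → Set) → Set
S ⊆ᵛ T = ∀ {a} → S a → ∃ λ b → T b × val a ≡ val b

-- A cover constrains only values, never the expressions themselves, so inclusion up to equal values
-- is enough.
weaken : ∀ {S T} → S ⊆ᵛ T → Cov T → Cov S
weaken f (empty h) = empty λ s → h (proj₁ (proj₂ (f s)))
weaken f (single t h) = single t λ s → let _ , t∈ , eq = f s in trans eq (h t∈)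
weaken {S} f (union {T₁} {T₂} c d h) = union (weaken (λ x → x) c) (weaken (λ x → x) d) split
  where
  split : ∀ {a} → S a → (∃ λ b → T₁ b × val a ≡ val b) ⊎ (∃ λ b → T₂ b × val a ≡ val b)
  split s with f s
  ... | b , t , eq = [ (λ t₁ → inj₁ (b , t₁ , eq)) , (λ t₂ → inj₂ (b , t₂ , eq)) ]′ (h t)
weaken f (limit t h k) = limit t
  (λ s → let _ , t∈ , eq = f s in subst (_≼ _) (sym eq) (h t∈))
  (λ z z≺ → weaken (λ { (s , le) → let b , t∈ , eq = f s in b , (t∈ , subst (_≼ z) eq le) , eq }) (k z z≺))

union-list : ∀ {F : Expr → Expr → Set} → (∀ b → Cov (F b)) → ∀ bs → Cov (λ a → ∃ λ b → b ∈ bs × F b a)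
union-list cov [] = empty λ { (_ , () , _) }
union-list cov (b ∷ bs) = union (cov b) (union-list cov bs)
  λ { (_ , here refl , s) → inj₁ s ; (b′ , there p , s) → inj₂ (b′ , p , s) }

few : ∀ c → Cov (λ a → ones a ≤ c)
few c = weaken (λ {a} h → a , (a , ∈-exprs c a h , refl) , refl)
  (union-list (λ b → single {S = _≡ b} b (cong val)) (exprs c))

Products : (S T : Expr → Set) → Expr → Set
Products S T x = ∃ λ u → ∃ λ v → S u × T v × val x ≡ val u · val v

Below : (Expr → Set) → ℚ → Expr → Set
Below S z a = S a × val a ≼ z

-- If z < x · y, there are x′ < x and y′ < y with z < x′ · y′. A product of value at most `z` then
-- has its first factor at most `x′` or its second at most `y′`, and both parts are covered.
products-limit : ∀ {S T} r x y → 0ℚ ≺ x → 0ℚ ≺ y → x · y ≡ ι 3 · val r →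
  (∀ {a} → S a → val a ≼ x) → (∀ {a} → T a → val a ≼ y) →
  (∀ x′ → x′ ≺ x → Cov (Products (Below S x′) T)) →
  (∀ y′ → y′ ≺ y → Cov (Products S (Below T y′))) →
  Cov (Products S T)
products-limit {S} {T} r x y 0≺x 0≺y xy≡ S≼x T≼y covS covT = limit r
  (λ { (u , v , s , t , eq) → subst₂ _≼_ (sym eq) xy≡
       (ℚ.≤-trans (·-monoˡ-≼ (0≺val v) (S≼x s)) (·-monoʳ-≼ 0≺x (T≼y t))) })
  below
  where
  below : ∀ z → z ≺ ι 3 · val r → Cov (Below (Products S T) z)
  below z z≺ with ≺·-split₂ 0≺x 0≺y (subst (z ≺_) (sym xy≡) z≺)
  ... | x′ , y′ , 0≺x′ , x′≺x , y′≺y , z≺x′y′ = union (covS x′ x′≺x) (covT y′ y′≺y) split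
    where
    split : ∀ {a} → Below (Products S T) z a → Products (Below S x′) T a ⊎ Products S (Below T y′) a
    split {a} ((u , v , s , t , eq) , le) with ≺-or-≽ x′ (val u) | ≺-or-≽ y′ (val v)
    ... | inj₂ h | _ = inj₁ (u , v , (s , h) , t , eq)
    ... | inj₁ _ | inj₂ h = inj₂ (u , v , s , (t , h) , eq)
    ... | inj₁ p | inj₁ q = contradiction (subst (_≼ z) eq le) (≺⇒⋡ (ℚ.<-trans z≺x′y′
      (ℚ.<-trans (·-monoʳ-≺ 0≺x′ q) (·-monoˡ-≺ (0≺val v) p))))

0≺3 : 0ℚ ≺ ι 3
0≺3 = 0≺ι (s≤s z≤n)

0≺3val : ∀ t → 0ℚ ≺ ι 3 · val t
0≺3val t = subst (0ℚ ≺_) (trans (val-⊗ one t) (cong (_· val t) val-one)) (0≺val (one ⊗ t))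

val-one⊗ : ∀ e → val (one ⊗ e) ≡ ι 3 · val e
val-one⊗ e = trans (val-⊗ one e) (cong (_· val e) val-one)

3val·val : ∀ a b → ι 3 · val a · val b ≡ ι 3 · val (a ⊗ b)
3val·val a b = trans (·-assoc (ι 3) (val a) (val b)) (cong (ι 3 ·_) (sym (val-⊗ a b)))

val·3val : ∀ a b → val a · (ι 3 · val b) ≡ ι 3 · val (a ⊗ b)
val·3val a b = trans (x∙yz≡y∙xz (val a) (ι 3) (val b)) (cong (ι 3 ·_) (sym (val-⊗ a b)))

3val·3val : ∀ a b → ι 3 · val a · (ι 3 · val b) ≡ ι 3 · val (a ⊗ (one ⊗ b))
3val·3val a b = trans (cong (ι 3 · val a ·_) (sym (val-one⊗ b))) (3val·val a (one ⊗ b))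

-- Recursion on both covers. Beside a limit, a single value acts as a limit with nothing strictly
-- below it. The new limit point is again in 3P because a product of an element of 3P with one of P
-- or 3P is.
products : ∀ {S T} → Cov S → Cov T → Cov (Products S T)
products (empty h) _ = empty λ { (_ , _ , s , _) → h s }
products (union c d h) e = union (products c e) (products d e)
  λ { (u , v , s , t) → [ (λ s₁ → inj₁ (u , v , s₁ , t)) , (λ s₂ → inj₂ (u , v , s₂ , t)) ]′ (h s) }
products (single _ _) (empty h) = empty λ { (_ , _ , _ , t , _) → h t }
products (limit _ _ _) (empty h) = empty λ { (_ , _ , _ , t , _) → h t }
products c@(single _ _) (union d e h) = union (products c d) (products c e)
  λ { (u , v , s , t , eq) → [ (λ t₁ → inj₁ (u , v , s , t₁ , eq)) , (λ t₂ → inj₂ (u , v , s , t₂ , eq)) ]′ (h t) }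
products c@(limit _ _ _) (union d e h) = union (products c d) (products c e)
  λ { (u , v , s , t , eq) → [ (λ t₁ → inj₁ (u , v , s , t₁ , eq)) , (λ t₂ → inj₂ (u , v , s , t₂ , eq)) ]′ (h t) }
products (single t h) (single t′ h′) = single (t ⊗ t′)
  λ { (_ , _ , s , s′ , eq) → trans eq (trans (cong₂ _·_ (h s) (h′ s′)) (sym (val-⊗ t t′))) }
products c@(single t h) (limit t′ h′ k′) = products-limit (t ⊗ t′) (val t) (ι 3 · val t′) (0≺val t) (0≺3val t′)
  (val·3val t t′)
  (λ s → ℚ.≤-reflexive (h s)) h′
  (λ x′ x′≺ → empty λ { (_ , _ , (s , le) , _) → ≺⇒⋡ (subst (x′ ≺_) (sym (h s)) x′≺) le })
  (λ y′ y′≺ → products c (k′ y′ y′≺))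
products (limit t h k) d@(single t′ h′) = products-limit (t ⊗ t′) (ι 3 · val t) (val t′) (0≺3val t) (0≺val t′)
  (3val·val t t′)
  h (λ s → ℚ.≤-reflexive (h′ s))
  (λ x′ x′≺ → products (k x′ x′≺) d)
  (λ y′ y′≺ → empty λ { (_ , _ , _ , (s , le) , _) → ≺⇒⋡ (subst (y′ ≺_) (sym (h′ s)) y′≺) le })
products c@(limit t h k) d@(limit t′ h′ k′) = products-limit (t ⊗ (one ⊗ t′)) (ι 3 · val t) (ι 3 · val t′)
  (0≺3val t) (0≺3val t′)
  (3val·3val t t′)
  h h′
  (λ x′ x′≺ → products (k x′ x′≺) d)
  (λ y′ y′≺ → products c (k′ y′ y′≺))

Sums : Expr → (Expr → Set) → Expr → Set
Sums b S x = ∃ λ a → S a × val x ≡ val (a ⊕ b)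

-- Sums of value at most `z`, with `z` below the limit, have either `val a ≤ x′` for some x′ < x, or
-- `val a` above `x′`. In the second case `⊕-bounded` limits the ones, leaving finitely many.
sums-limit : ∀ {S} b r x → 0ℚ ≺ x → x · ι (3 ^ ones b) ≡ ι 3 · val r →
  (∀ {a} → S a → val a ≼ x) → (∀ x′ → x′ ≺ x → Cov (Sums b (Below S x′))) → Cov (Sums b S)
sums-limit {S} b r x 0≺x x≡ S≼x cov = limit r
  (λ { (a , s , eq) → subst₂ _≼_ (sym eq) x≡ (ℚ.≤-trans (ℚ.<⇒≤ (val-⊕≺ a b)) (·-monoˡ-≼ 0≺3^b (S≼x s))) })
  below
  where
  0≺3^b = 0≺ι (1≤3^ (ones b))
  below : ∀ z → z ≺ ι 3 · val r → Cov (Below (Sums b S) z)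
  below z z≺ with ≺·-split 0≺x 0≺3^b (subst (z ≺_) (sym x≡) z≺)
  ... | x′ , 0≺x′ , x′≺x , z≺′ with ⊕-bounded b x′ z 0≺x′ z≺′
  ... | c , bounded = union (cov x′ x′≺x) (weaken {S = λ e → ∃ λ a → ones a ≤ c × val e ≡ val a} (λ h → h) (few c)) split
    where
    split : ∀ {e} → Below (Sums b S) z e → Sums b (Below S x′) e ⊎ (∃ λ a → ones a ≤ c × val e ≡ val a)
    split ((a , s , eq) , le) with ≺-or-≽ x′ (val a)
    ... | inj₁ h = inj₂ (a ⊕ b , bounded a (ℚ.<⇒≤ h) (subst (_≼ z) eq le) , eq)
    ... | inj₂ h = inj₁ (a , (s , h) , eq)

-- A factor 1 costs a one and keeps the number, so it triples the value. This puts 3P inside P.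
tower : ℕ → Expr → Expr
tower zero e = e
tower (suc k) e = one ⊗ tower k e

val-tower : ∀ k e → val (tower k e) ≡ ι (3 ^ k) · val e
val-tower zero e = sym (·-identityˡ (val e))
val-tower (suc k) e = begin
  val (one ⊗ tower k e)        ≡⟨ val-one⊗ (tower k e) ⟩
  ι 3 · val (tower k e)        ≡⟨ cong (ι 3 ·_) (val-tower k e) ⟩
  ι 3 · (ι (3 ^ k) · val e)    ≡⟨ ·-assoc (ι 3) (ι (3 ^ k)) (val e) ⟨
  ι 3 · ι (3 ^ k) · val e      ≡⟨ cong (_· val e) (ι-* 3 (3 ^ k)) ⟨
  ι (3 ^ suc k) · val e        ∎
  where open ≡-Reasoning

val·3^ : ∀ k e → val e · ι (3 ^ k) ≡ val (tower k e)
val·3^ k e = trans (·-comm (val e) (ι (3 ^ k))) (sym (val-tower k e))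

3val·3^ : ∀ k e → ι 3 · val e · ι (3 ^ k) ≡ ι 3 · val (tower k e)
3val·3^ k e = trans (·-assoc (ι 3) (val e) (ι (3 ^ k))) (cong (ι 3 ·_) (val·3^ k e))

val·3^pos : ∀ k e → 1 ≤ k → val e · ι (3 ^ k) ≡ ι 3 · val (tower (pred k) e)
val·3^pos (suc k) e _ = trans (val·3^ (suc k) e) (val-one⊗ (tower k e))

-- Even a single value can create a limit: adding `b` to ever larger numbers of value `val t`
-- approaches `val t` · 3 ^ `ones b`. This lies in 3P because `b` has at least one 1.
sums : ∀ {S} b → Cov S → Cov (Sums b S)
sums b (empty h) = empty λ { (_ , s , _) → h s }
sums b (union c d h) = union (sums b c) (sums b d)
  λ { (a , s , eq) → [ (λ s₁ → inj₁ (a , s₁ , eq)) , (λ s₂ → inj₂ (a , s₂ , eq)) ]′ (h s) }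
sums b (single t h) = sums-limit b (tower (pred (ones b)) t) (val t) (0≺val t)
  (val·3^pos (ones b) t (1≤ones b))
  (λ s → ℚ.≤-reflexive (h s))
  (λ x′ x′≺ → empty λ { (_ , (s , le) , _) → ≺⇒⋡ (subst (x′ ≺_) (sym (h s)) x′≺) le })
sums b (limit t h k) = sums-limit b (tower (ones b) t) (ι 3 · val t) (0≺3val t)
  (3val·3^ (ones b) t) h (λ x′ x′≺ → sums b (k x′ x′≺))

-- Compactness of the values up to (9/8)ᵐ

bound : ℕ → ℚ
bound m = proj₁ (quotient (9 ^ m) (8 ^ m) (m^n>0 8 m))

bound-isFrac : ∀ m → IsFrac (bound m) (9 ^ m) (8 ^ m)
bound-isFrac m = proj₂ (quotient (9 ^ m) (8 ^ m) (m^n>0 8 m))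

Level : ℕ → Expr → Set
Level m e = val e ≼ bound m

level⁻ : ∀ m e → Level m e → 3 ^ ones e * 8 ^ m ≤ 9 ^ m * cube (eval e)
level⁻ m e = frac-≤⁻ (val-isFrac e) (bound-isFrac m)

level⁺ : ∀ m e → 3 ^ ones e * 8 ^ m ≤ 9 ^ m * cube (eval e) → Level m e
level⁺ m e = frac-≤⁺ (val-isFrac e) (bound-isFrac m)

private
  bernoulli : ∀ m → 8 ^ m * (8 + m) ≤ 8 * 9 ^ m
  bernoulli zero = ≤-refl
  bernoulli (suc m) = begin
    8 * 8 ^ m * (8 + suc m)                        ≤⟨ m≤m+n _ (8 ^ m * m) ⟩
    8 * 8 ^ m * (8 + suc m) + 8 ^ m * m            ≡⟨ ring (8 ^ m) m ⟩
    9 * (8 ^ m * (8 + m))                          ≤⟨ *-monoʳ-≤ 9 (bernoulli m) ⟩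
    9 * (8 * 9 ^ m)                                ≡⟨ ring′ (9 ^ m) ⟩
    8 * (9 * 9 ^ m)                                ∎
    where
    open ≤-Reasoning
    ring : ∀ x m → 8 * x * (8 + suc m) + x * m ≡ 9 * (x * (8 + m))
    ring = solve-∀
    ring′ : ∀ y → 9 * (8 * y) ≡ 8 * (9 * y)
    ring′ = solve-∀

-- Bernoulli's inequality gives (9/8)ᵐ ≥ 1 + m/8, and m/8 is chosen as 3 ^ `ones e`, which is at
-- least `val e`.
∃level : ∀ e → ∃ λ m → Level m e
∃level e = m , level⁺ m e (*-cancelˡ-≤ 8 (begin
  8 * (3 ^ ones e * 8 ^ m)     ≡⟨ ring (3 ^ ones e) (8 ^ m) ⟩
  8 ^ m * m                    ≤⟨ *-monoʳ-≤ (8 ^ m) (m≤n+m m 8) ⟩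
  8 ^ m * (8 + m)              ≤⟨ bernoulli m ⟩
  8 * 9 ^ m                    ≤⟨ *-monoʳ-≤ 8 (m≤m*n (9 ^ m) (cube (eval e)) {{>-nonZero (1≤cube e)}}) ⟩
  8 * (9 ^ m * cube (eval e))  ∎))
  where
  open ≤-Reasoning
  m = 8 * 3 ^ ones e
  ring : ∀ x y → 8 * (x * y) ≡ y * (8 * x)
  ring = solve-∀

-- A crude common bound: 27 = 3³ serves the numbers up to 3, and also exceeds the factor 8 = 2³
-- coming from a + b ≤ 2a.
few-bound : ℕ → ℕ
few-bound m = 27 * 9 ^ suc m

data Step (m : ℕ) (e : Expr) : Set where
  trivial : val e ≡ val three → Step m e
  product : Products (Level m) (Level m) e → Step m e
  bounded : (∃ λ a → ones a ≤ few-bound m × val e ≡ val a) → Step m e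
  summed  : (∃ λ b → b ∈ exprs (few-bound m) × Sums b (Level m) e) → Step m e

step-resp : ∀ {m e e′} → val e ≡ val e′ → Step m e′ → Step m e
step-resp eq (trivial p) = trivial (trans eq p)
step-resp eq (product (u , v , s , t , p)) = product (u , v , s , t , trans eq p)
step-resp eq (bounded (a , h , p)) = bounded (a , h , trans eq p)
step-resp eq (summed (b , h , a , s , p)) = summed (b , h , a , s , trans eq p)

private
  -- In fractions, xy/z is at most 9/8 · n/m and at least 9/8 · x/w. Cancelling 9/8 lowers the level
  -- by one, for summands and factors alike.
  descend : ∀ x y m n z w → 1 ≤ y → x * y * (8 * m) ≤ 9 * n * z → 9 * z ≤ 8 * (y * w) → x * m ≤ n * w
  descend x y m n z w 1≤y h k = *-cancelˡ-≤ (8 * y) {{m*n≢0 8 y {{_}} {{>-nonZero 1≤y}}}} (begin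
    8 * y * (x * m)     ≡⟨ ring₁ x y m ⟩
    x * y * (8 * m)     ≤⟨ h ⟩
    9 * n * z           ≡⟨ ring₂ n z ⟩
    n * (9 * z)         ≤⟨ *-monoʳ-≤ n k ⟩
    n * (8 * (y * w))   ≡⟨ ring₃ y n w ⟩
    8 * y * (n * w)     ∎)
    where
    open ≤-Reasoning
    ring₁ : ∀ x y m → 8 * y * (x * m) ≡ x * y * (8 * m)
    ring₁ = solve-∀
    ring₂ : ∀ n z → 9 * n * z ≡ n * (9 * z)
    ring₂ = solve-∀
    ring₃ : ∀ y n w → n * (8 * (y * w)) ≡ 8 * y * (n * w)
    ring₃ = solve-∀

level-summand : ∀ m a b → eval b ≤ eval a → 2 ≤ ones b ⊎ 3 ≤ eval a → Level (suc m) (a ⊕ b) → Level m a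
level-summand m a b b≤a h l = level⁺ m a
  (descend (3 ^ ones a) (3 ^ ones b) (8 ^ m) (9 ^ m) _ _ (1≤3^ (ones b))
    (subst (λ k → k * 8 ^ suc m ≤ 9 ^ suc m * cube (eval a + eval b))
      (^-distribˡ-+-* 3 (ones a) (ones b)) (level⁻ (suc m) (a ⊕ b) l))
    (summand-drop a b b≤a h))

level-factor : ∀ m a b → 9 * cube (eval b) ≤ 8 * 3 ^ ones b → Level (suc m) (a ⊗ b) → Level m a
level-factor m a b h l = level⁺ m a
  (descend (3 ^ ones a) (3 ^ ones b) (8 ^ m) (9 ^ m) _ _ (1≤3^ (ones b))
    (subst₂ (λ k n → k * 8 ^ suc m ≤ 9 ^ suc m * n)
      (^-distribˡ-+-* 3 (ones a) (ones b)) (cube-* (eval a) (eval b)) (level⁻ (suc m) (a ⊗ b) l))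
    (begin
      9 * (cube (eval a) * cube (eval b))   ≡⟨ ring₁ (cube (eval a)) (cube (eval b)) ⟩
      9 * cube (eval b) * cube (eval a)     ≤⟨ *-monoˡ-≤ (cube (eval a)) h ⟩
      8 * 3 ^ ones b * cube (eval a)        ≡⟨ *-assoc 8 (3 ^ ones b) (cube (eval a)) ⟩
      8 * (3 ^ ones b * cube (eval a))      ∎))
  where
  open ≤-Reasoning
  ring₁ : ∀ x y → 9 * (x * y) ≡ 9 * y * x
  ring₁ = solve-∀

level⇒ones≤ : ∀ m e → cube (eval e) ≤ 27 → Level (suc m) e → ones e ≤ few-bound m
level⇒ones≤ m e small l = begin
  ones e                       ≤⟨ <⇒≤ (n<3^n (ones e)) ⟩
  3 ^ ones e                   ≤⟨ m≤m*n (3 ^ ones e) (8 ^ suc m) {{m^n≢0 8 (suc m)}} ⟩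
  3 ^ ones e * 8 ^ suc m       ≤⟨ level⁻ (suc m) e l ⟩
  9 ^ suc m * cube (eval e)    ≤⟨ *-monoʳ-≤ (9 ^ suc m) small ⟩
  9 ^ suc m * 27               ≡⟨ *-comm (9 ^ suc m) 27 ⟩
  few-bound m                  ∎
  where open ≤-Reasoning

-- Adding `b` multiplies the weight by 3 ^ `ones b` but the cube by at most 8, and `val a` is at
-- least 1. Hence 3 ^ `ones b` is at most 8 · (9/8)ᵐ⁺¹, and only finitely many `b` occur.
ones-summand≤ : ∀ m a b → eval b ≤ eval a → Level (suc m) (a ⊕ b) → ones b ≤ few-bound m
ones-summand≤ m a b b≤a l = ≤-trans (<⇒≤ (n<3^n (ones b)))
  (*-cancelˡ-≤ (3 ^ ones a) {{m^n≢0 3 (ones a)}} (begin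
    3 ^ ones a * 3 ^ ones b                   ≡⟨ ^-distribˡ-+-* 3 (ones a) (ones b) ⟨
    3 ^ ones (a ⊕ b)                          ≤⟨ m≤m*n _ (8 ^ suc m) {{m^n≢0 8 (suc m)}} ⟩
    3 ^ ones (a ⊕ b) * 8 ^ suc m              ≤⟨ level⁻ (suc m) (a ⊕ b) l ⟩
    9 ^ suc m * cube (eval a + eval b)        ≤⟨ *-monoʳ-≤ (9 ^ suc m) (cube-mono-≤ (+-monoʳ-≤ (eval a) b≤a)) ⟩
    9 ^ suc m * cube (eval a + eval a)        ≡⟨ ring (9 ^ suc m) (eval a) ⟩
    8 * 9 ^ suc m * cube (eval a)             ≤⟨ *-mono-≤ (*-monoˡ-≤ (9 ^ suc m) (m≤m+n 8 19)) (cube≤3^ones a) ⟩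
    27 * 9 ^ suc m * 3 ^ ones a               ≡⟨ *-comm (few-bound m) (3 ^ ones a) ⟩
    3 ^ ones a * few-bound m                  ∎))
  where
  open ≤-Reasoning
  ring : ∀ x y → x * ((y + y) * (y + y) * (y + y)) ≡ 8 * x * (y * y * y)
  ring = solve-∀

step-⊕ : ∀ m a b → eval b ≤ eval a → Level (suc m) (a ⊕ b) → Step m (a ⊕ b)
step-⊕ m a b b≤a l = cases (one-or-2≤ones b) (3 ≤? eval a)
  where
  drop : 2 ≤ ones b ⊎ 3 ≤ eval a → Step m (a ⊕ b)
  drop h = summed (b , ∈-exprs (few-bound m) b (ones-summand≤ m a b b≤a l) , a , level-summand m a b b≤a h l , refl)
  cases : b ≡ one ⊎ 2 ≤ ones b → Dec (3 ≤ eval a) → Step m (a ⊕ b)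
  cases (inj₂ h) _ = drop (inj₁ h)
  cases (inj₁ _) (yes h) = drop (inj₂ h)
  cases (inj₁ refl) (no h) = bounded (a ⊕ one ,
    level⇒ones≤ m (a ⊕ one) (cube-mono-≤ (≤-trans (+-monoˡ-≤ 1 (≤-pred (≰⇒> h))) ≤-refl)) l , refl)

cube≡3^⇒val : ∀ e → cube (eval e) ≡ 3 ^ ones e → val e ≡ val three
cube≡3^⇒val e eq = frac-≡⁺ (val-isFrac e) (val-isFrac three) (trans (*-comm (3 ^ ones e) 27) (cong (27 *_) (sym eq)))

val-trivial-⊗ : ∀ a b → val a ≡ val three → val (a ⊗ b) ≡ val b
val-trivial-⊗ a b eq = trans (val-⊗ a b) (trans (cong (_· val b) (trans eq val-three)) (·-identityˡ (val b)))

val-⊗-comm : ∀ a b → val (a ⊗ b) ≡ val (b ⊗ a)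
val-⊗-comm a b = trans (val-⊗ a b) (trans (·-comm (val a) (val b)) (sym (val-⊗ b a)))

val-⊕-comm : ∀ a b → val (a ⊕ b) ≡ val (b ⊕ a)
val-⊕-comm a b = frac-≡⁺ (val-isFrac (a ⊕ b)) (val-isFrac (b ⊕ a))
  (cong₂ (λ c n → 3 ^ c * cube n) (+-comm (ones a) (ones b)) (+-comm (eval b) (eval a)))

-- A factor of value 1 is discarded without changing the value or the level. If neither factor has
-- value 1, each is at least 9/8, so each lies one level lower.
step : ∀ m e → Level (suc m) e → Step m e
step m one l = bounded (one , level⇒ones≤ m one (s≤s z≤n) l , refl)
step m (a ⊕ b) l with ≤-total (eval b) (eval a)
... | inj₁ b≤a = step-⊕ m a b b≤a l
... | inj₂ a≤b = step-resp (val-⊕-comm a b) (step-⊕ m b a a≤b (subst (_≼ _) (val-⊕-comm a b) l))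
step m (a ⊗ b) l with gap a | gap b
... | inj₁ p | _ = let eq = val-trivial-⊗ a b (cube≡3^⇒val a p) in
  step-resp eq (step m b (subst (_≼ _) eq l))
... | inj₂ _ | inj₁ q = let eq = trans (val-⊗-comm a b) (val-trivial-⊗ b a (cube≡3^⇒val b q)) in
  step-resp eq (step m a (subst (_≼ _) eq l))
... | inj₂ p | inj₂ q = product (a , b , level-factor m a b q l ,
  level-factor m b a p (subst (_≼ _) (val-⊗-comm a b) l) , val-⊗ a b)

step-sum : ∀ {m e} → Step m e → val e ≡ val three
  ⊎ Products (Level m) (Level m) e
  ⊎ (∃ λ a → ones a ≤ few-bound m × val e ≡ val a)
  ⊎ (∃ λ b → b ∈ exprs (few-bound m) × Sums b (Level m) e)
step-sum (trivial h) = inj₁ h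
step-sum (product h) = inj₂ (inj₁ h)
step-sum (bounded h) = inj₂ (inj₂ (inj₁ h))
step-sum (summed h) = inj₂ (inj₂ (inj₂ h))

opaque
  cov-level : ∀ m → Cov (Level m)
  cov-level zero = single three λ {a} l → ℚ.≤-antisym
    (ℚ.≤-trans l (frac-≤⁺ (bound-isFrac 0) (val-isFrac three) ≤-refl))
    (subst (_≼ val a) (sym val-three) (1≼val a))
  cov-level (suc m) = union (single {S = λ e → val e ≡ val three} three (λ h → h))
    (union (products (cov-level m) (cov-level m))
      (union (weaken {S = λ e → ∃ λ a → ones a ≤ few-bound m × val e ≡ val a} (λ h → h) (few (few-bound m)))
        (union-list (λ b → sums b (cov-level m)) (exprs (few-bound m)))
        (λ h → h))
      (λ h → h))
    (λ {a} l → step-sum (step m a l))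

-- Successors and fundamental sequences

-- `p` need not belong to `S`: any value above `y` that bounds the later part of `S` from below
-- qualifies. For `S` all expressions it is the true successor.
LeastAbove : (Expr → Set) → ℚ → Expr → Set
LeastAbove S y p = y ≺ val p × (∀ {a} → S a → y ≺ val a → val p ≼ val a)

-- At a limit point above `y`, `approach` supplies a candidate `p` short of the limit. Only the part
-- of `S` up to `val p` can beat it, and that part has a cover of its own.
next-in : ∀ {S} → Cov S → ∀ y → (∀ {a} → S a → val a ≼ y) ⊎ ∃ (LeastAbove S y)
next-in (empty h) y = inj₁ λ s → contradiction s h
next-in (single t h) y with ≺-or-≽ y (val t)
... | inj₁ y≺t = inj₂ (t , y≺t , λ s _ → ℚ.≤-reflexive (sym (h s)))
... | inj₂ t≼y = inj₁ λ s → subst (_≼ y) (sym (h s)) t≼y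
next-in (union c d h) y with next-in c y | next-in d y
... | inj₁ f | inj₁ g = inj₁ λ s → [ f , g ]′ (h s)
... | inj₁ f | inj₂ (p , y≺p , g) = inj₂ (p , y≺p ,
  λ s y≺ → [ (λ s₁ → contradiction (f s₁) (≺⇒⋡ y≺)) , (λ s₂ → g s₂ y≺) ]′ (h s))
... | inj₂ (p , y≺p , f) | inj₁ g = inj₂ (p , y≺p ,
  λ s y≺ → [ (λ s₁ → f s₁ y≺) , (λ s₂ → contradiction (g s₂) (≺⇒⋡ y≺)) ]′ (h s))
... | inj₂ (p , y≺p , f) | inj₂ (q , y≺q , g) with ≺-or-≽ (val p) (val q)
...   | inj₁ p≺q = inj₂ (p , y≺p ,
  λ s y≺ → [ (λ s₁ → f s₁ y≺) , (λ s₂ → ℚ.≤-trans (ℚ.<⇒≤ p≺q) (g s₂ y≺)) ]′ (h s))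
...   | inj₂ q≼p = inj₂ (q , y≺q ,
  λ s y≺ → [ (λ s₁ → ℚ.≤-trans q≼p (f s₁ y≺)) , (λ s₂ → g s₂ y≺) ]′ (h s))
next-in (limit t h k) y with ≺-or-≽ y (ι 3 · val t)
... | inj₂ t≼y = inj₁ λ s → ℚ.≤-trans (h s) t≼y
... | inj₁ y≺t with approach t y y≺t
...   | p , y≺p , p≺t with next-in (k (val p) p≺t) y
...     | inj₁ f = inj₂ (p , y≺p , λ {a} s y≺ →
  [ ℚ.<⇒≤ , (λ a≼p → contradiction (f (s , a≼p)) (≺⇒⋡ y≺)) ]′ (≺-or-≽ (val p) (val a)))
...     | inj₂ (q , y≺q , f) with ≺-or-≽ (val p) (val q)
...       | inj₁ p≺q = inj₂ (p , y≺p , λ {a} s y≺ →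
  [ ℚ.<⇒≤ , (λ a≼p → ℚ.≤-trans (ℚ.<⇒≤ p≺q) (f (s , a≼p) y≺)) ]′ (≺-or-≽ (val p) (val a)))
...       | inj₂ q≼p = inj₂ (q , y≺q , λ {a} s y≺ →
  [ (λ p≺a → ℚ.≤-trans q≼p (ℚ.<⇒≤ p≺a)) , (λ a≼p → f (s , a≼p) y≺) ]′ (≺-or-≽ (val p) (val a)))

-- The hypothesis says that no 3 · val t lies in the interval from y (excluded) to x (included).
finite-between : ∀ {S} → Cov S → ∀ y x → (∀ t → y ≺ ι 3 · val t → x ≺ ι 3 · val t) →
  ∃ λ bs → ∀ {a} → S a → y ≺ val a → val a ≼ x → Any (λ b → val b ≡ val a) bs
finite-between (empty h) y x free = [] , λ s → contradiction s h
finite-between (single t h) y x free = t ∷ [] , λ s _ _ → here (sym (h s))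
finite-between (union c d h) y x free with finite-between c y x free | finite-between d y x free
... | bs , f | bs′ , g = bs ++ bs′ , λ s y≺ ≼x →
  [ (λ s₁ → ++⁺ˡ (f s₁ y≺ ≼x)) , (λ s₂ → ++⁺ʳ bs (g s₂ y≺ ≼x)) ]′ (h s)
finite-between (limit t h k) y x free with ≺-or-≽ y (ι 3 · val t)
... | inj₂ t≼y = [] , λ s y≺ _ → contradiction (ℚ.≤-trans (h s) t≼y) (≺⇒⋡ y≺)
... | inj₁ y≺t with finite-between (k x (free t y≺t)) y x free
...   | bs , f = bs , λ s y≺ ≼x → f (s , ≼x) y≺ ≼x

-- The positive answer says only that `x` is a value, possibly of an expression outside `S`. So when
-- `x` is itself the limit point 3 · `val t`, the expression `one ⊗ t` settles the question.
member-of : ∀ {S} → Cov S → ∀ x → (∃ λ p → val p ≡ x) ⊎ (∀ {a} → S a → val a ≢ x)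
member-of (empty h) x = inj₂ λ s → contradiction s h
member-of (single t h) x with val t ℚ.≟ x
... | yes eq = inj₁ (t , eq)
... | no neq = inj₂ λ s eq → neq (trans (sym (h s)) eq)
member-of (union c d h) x with member-of c x | member-of d x
... | inj₁ p | _ = inj₁ p
... | inj₂ _ | inj₁ p = inj₁ p
... | inj₂ f | inj₂ g = inj₂ λ s → [ f , g ]′ (h s)
member-of (limit t h k) x with ≺-or-≽ x (ι 3 · val t)
... | inj₁ x≺t with member-of (k x x≺t) x
...   | inj₁ p = inj₁ p
...   | inj₂ f = inj₂ λ s eq → f (s , ℚ.≤-reflexive eq) eq
member-of (limit t h k) x | inj₂ t≼x with ι 3 · val t ℚ.≟ x
...   | yes eq = inj₁ (one ⊗ t , trans (val-one⊗ t) eq)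
...   | no neq = inj₂ λ s eq → neq (ℚ.≤-antisym t≼x (subst (_≼ ι 3 · val t) eq (h s)))

∃val≻ : ∀ y → ∃ λ e → y ≺ val e
∃val≻ y =
  let k , y≼k = ≼ι y
  in tower k three , ℚ.≤-<-trans y≼k (subst (ι k ≺_) (3^k≡ k) (ι-mono-< (n<3^n k)))
  where
  3^k≡ : ∀ k → ι (3 ^ k) ≡ val (tower k three)
  3^k≡ k = sym (trans (val-tower k three) (trans (cong (ι (3 ^ k) ·_) val-three) (·-identityʳ _)))

∃level≻ : ∀ y → ∃ λ m → y ≺ bound m
∃level≻ y = let e , y≺e = ∃val≻ y ; m , e≼m = ∃level e in m , ℚ.<-≤-trans y≺e e≼m

-- The level is chosen to contain some `e₀` above `y`. Values beyond it exceed `val e₀`, so the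
-- least one is found inside the level.
least-above : ∀ y → ∃ (LeastAbove (λ _ → ⊤) y)
least-above y =
  let e₀ , y≺e₀ = ∃val≻ y
      m , e₀≼m = ∃level e₀
  in extend e₀ m y≺e₀ e₀≼m (next-in (cov-level m) y)
  where
  extend : ∀ e₀ m → y ≺ val e₀ → Level m e₀ →
    (∀ {a} → Level m a → val a ≼ y) ⊎ ∃ (LeastAbove (Level m) y) → ∃ (LeastAbove (λ _ → ⊤) y)
  extend e₀ m y≺e₀ e₀≼m (inj₁ f) = contradiction (f e₀≼m) (≺⇒⋡ y≺e₀)
  extend e₀ m y≺e₀ e₀≼m (inj₂ (p , y≺p , f)) = p , y≺p , λ {a} _ y≺a →
    [ (λ m≺a → ℚ.≤-trans (f e₀≼m y≺e₀) (ℚ.≤-trans e₀≼m (ℚ.<⇒≤ m≺a))) , (λ a≼m → f a≼m y≺a) ]′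
      (≺-or-≽ (bound m) (val a))

opaque
  next : ℚ → Expr
  next y = proj₁ (least-above y)

  ≺next : ∀ y → y ≺ val (next y)
  ≺next y = proj₁ (proj₂ (least-above y))

  next-least : ∀ y e → y ≺ val e → val (next y) ≼ val e
  next-least y e = proj₂ (proj₂ (least-above y)) tt

InP : ℚ → Set
InP x = ∃ λ e → val e ≡ x

opaque
  inP? : ∀ x → Dec (InP x)
  inP? x = let m , x≺m = ∃level≻ x in decide m x≺m (member-of (cov-level m) x)
    where
    decide : ∀ m → x ≺ bound m → (∃ λ p → val p ≡ x) ⊎ (∀ {a} → Level m a → val a ≢ x) → Dec (InP x)
    decide m x≺m (inj₁ p) = yes p
    decide m x≺m (inj₂ f) = no λ { (e , eq) → f (subst (_≼ bound m) (sym eq) (ℚ.<⇒≤ x≺m)) eq }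

opaque
  third : ℚ → ℚ
  third x = proj₁ (inverse 0≺3) · x

  third-3 : ∀ x → third (ι 3 · x) ≡ x
  third-3 x = trans (sym (·-assoc _ (ι 3) x)) (trans (cong (_· x) (proj₂ (inverse 0≺3))) (·-identityˡ x))

  3-third : ∀ x → ι 3 · third x ≡ x
  3-third x = trans (x∙yz≡y∙xz (ι 3) _ x) (third-3 x)

third≺ : ∀ {x y} → x ≺ ι 3 · y → third x ≺ y
third≺ {x} {y} h = ·-cancelˡ-≺ 0≺3 (subst (_≺ ι 3 · y) (sym (3-third x)) h)

third≼ : ∀ {x y} → x ≼ y → third x ≼ third y
third≼ {x} {y} h = ·-cancelˡ-≼ 0≺3 (subst₂ _≼_ (sym (3-third x)) (sym (3-third y)) h)

iter : (ℚ → ℚ) → ℕ → ℚ → ℚ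
iter s zero y = y
iter s (suc n) y = s (iter s n y)

iter-+ : ∀ s m n y → iter s m (iter s n y) ≡ iter s (m + n) y
iter-+ s zero n y = refl
iter-+ s (suc m) n y = cong s (iter-+ s m n y)

-- Expresses that y, s y, s (s y), ... increases and has limit `ℓ y`.
record Fundamental (s ℓ : ℚ → ℚ) : Set where
  field
    grows : ∀ y → y ≺ s y
    ≺lim  : ∀ y → y ≺ ℓ y
    stays : ∀ y z → y ≼ z → z ≺ ℓ y → s z ≺ ℓ y
    reach : ∀ y x → x ≺ ℓ y → ∃ λ k → x ≺ iter s k y

  iter-≽ : ∀ n y → y ≼ iter s n y
  iter-≽ zero y = ℚ.≤-refl
  iter-≽ (suc n) y = ℚ.≤-trans (iter-≽ n y) (ℚ.<⇒≤ (grows _))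

  iter-≺ : ∀ n y → iter s n y ≺ ℓ y
  iter-≺ zero y = ≺lim y
  iter-≺ (suc n) y = stays y _ (iter-≽ n y) (iter-≺ n y)

  iter-mono : ∀ {m n} y → m ≤ n → iter s m y ≼ iter s n y
  iter-mono {m} y m≤n with m≤n⇒∃[o]m+o≡n m≤n
  ... | o , refl = subst (iter s m y ≼_) (trans (iter-+ s o m y) (cong (λ k → iter s k y) (+-comm o m)))
    (iter-≽ o (iter s m y))

  locate : ∀ y x → y ≼ x → x ≺ ℓ y → ∃ λ n → iter s n y ≼ x × x ≺ iter s (suc n) y
  locate y x y≼x x≺ℓ = let k , h = reach y x x≺ℓ in go k h
    where
    go : ∀ k → x ≺ iter s k y → ∃ λ n → iter s n y ≼ x × x ≺ iter s (suc n) y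
    go zero h = contradiction y≼x (≺⇒⋡ h)
    go (suc k) h with ≺-or-≽ x (iter s k y)
    ... | inj₁ h′ = go k h′
    ... | inj₂ h′ = k , h′ , h

-- Conjugation by multiplication by 3: it turns the successor in a set X into the successor in 3X.
lift₃ : (ℚ → ℚ) → ℚ → ℚ
lift₃ s y = ι 3 · s (third y)

iter-lift₃ : ∀ s n y → iter (lift₃ s) n y ≡ ι 3 · iter s n (third y)
iter-lift₃ s zero y = sym (3-third y)
iter-lift₃ s (suc n) y = cong (λ x → ι 3 · s x) (trans (cong third (iter-lift₃ s n y)) (third-3 _))

fundamental-lift₃ : ∀ {s ℓ} → Fundamental s ℓ → Fundamental (lift₃ s) (lift₃ ℓ)
fundamental-lift₃ {s} {ℓ} F = record
  { grows = λ y → expand (grows (third y))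
  ; ≺lim = λ y → expand (≺lim (third y))
  ; stays = λ y z y≼z z≺ → ·-monoʳ-≺ 0≺3 (stays (third y) (third z) (third≼ y≼z) (third≺ z≺))
  ; reach = λ y x x≺ → let k , h = reach (third y) (third x) (third≺ x≺) in
      k , subst (x ≺_) (sym (iter-lift₃ s k y)) (expand h)
  }
  where
  open Fundamental F
  expand : ∀ {x y} → third x ≺ y → x ≺ ι 3 · y
  expand {x} {y} h = subst (_≺ ι 3 · y) (3-third x) (·-monoʳ-≺ 0≺3 h)

nextVal : ℚ → ℚ
nextVal y = val (next y)

AnyVal : ℚ → List Expr → Set
AnyVal x = Any (λ b → val b ≡ x)

drop-≢ : ∀ {x b bs} → val b ≢ x → AnyVal x (b ∷ bs) → AnyVal x bs
drop-≢ neq (here eq) = contradiction eq neq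
drop-≢ neq (there p) = p

-- Induction on a list covering the values strictly between `y` and `x`. If its head `b` lies
-- between them, first climb to `val b`, then on to `x`; neither stretch has `val b` strictly
-- inside, so the tail covers both.
reach-list : ∀ bs y x → (∀ a → y ≺ val a → val a ≺ x → AnyVal (val a) bs) →
  ∃ λ k → x ≼ iter nextVal k y
reach-list [] y x cover = [ (λ h → contradiction (cover (next y) (≺next y) h) λ ()) , (1 ,_) ]′
  (≺-or-≽ (nextVal y) x)
reach-list (b ∷ bs) y x cover = cases ((y ℚ.<? val b) ×-dec (val b ℚ.<? x))
  where
  cases : Dec (y ≺ val b × val b ≺ x) → ∃ λ k → x ≼ iter nextVal k y
  cases (no out) = reach-list bs y x (λ a y≺a a≺x →
    drop-≢ (λ eq → out (subst (y ≺_) (sym eq) y≺a , subst (_≺ x) (sym eq) a≺x)) (cover a y≺a a≺x))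
  cases (yes (y≺b , b≺x)) =
    let k , b≼k = reach-list bs y (val b) (λ a y≺a a≺b →
          drop-≢ (≢-sym (ℚ.<⇒≢ a≺b)) (cover a y≺a (ℚ.<-trans a≺b b≺x)))
        k′ , x≼ = reach-list bs (iter nextVal k y) x (λ a k≺a a≺x →
          drop-≢ (ℚ.<⇒≢ (ℚ.≤-<-trans b≼k k≺a)) (cover a (ℚ.<-trans y≺b (ℚ.≤-<-trans b≼k k≺a)) a≺x))
    in k′ + k , subst (x ≼_) (iter-+ nextVal k′ k y) x≼

-- Below the next point of 3P there is always a further value by `approach`, so the successor never
-- jumps past it. Up to any earlier `x` no limit point intervenes, so `finite-between` leaves
-- finitely many values to pass.
fundamental-next : Fundamental nextVal (lift₃ nextVal)
fundamental-next = record
  { grows = ≺next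
  ; ≺lim = λ y → subst (_≺ lift₃ nextVal y) (3-third y) (·-monoʳ-≺ 0≺3 (≺next (third y)))
  ; stays = λ y z y≼z z≺ → let p , z≺p , p≺ = approach (next (third y)) z z≺ in
      ℚ.≤-<-trans (next-least z p z≺p) p≺
  ; reach = reached
  }
  where
  reached : ∀ y x → x ≺ lift₃ nextVal y → ∃ λ k → x ≺ iter nextVal k y
  reached y x x≺ =
    let m , x≺m = ∃level≻ x
        bs , cover = finite-between (cov-level m) y x λ t y≺t →
          ℚ.<-≤-trans x≺ (·-monoʳ-≼ 0≺3 (next-least (third y) t (third≺ y≺t)))
        k , h = reach-list bs y x λ a y≺a a≺x →
          cover (ℚ.<⇒≤ (ℚ.<-trans a≺x x≺m)) y≺a (ℚ.<⇒≤ a≺x)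
    in suc k , ℚ.≤-<-trans h (≺next (iter nextVal k y))

-- The successor in 3ⁱP.
level-step : ℕ → ℚ → ℚ
level-step zero = nextVal
level-step (suc i) = lift₃ (level-step i)

fundamental : ∀ i → Fundamental (level-step i) (level-step (suc i))
fundamental zero = fundamental-next
fundamental (suc i) = fundamental-lift₃ (fundamental i)

inP-level-step : ∀ i y → InP (level-step i y)
inP-level-step zero y = next y , refl
inP-level-step (suc i) y = let e , eq = inP-level-step i (third y) in
  one ⊗ e , trans (val-one⊗ e) (cong (ι 3 ·_) eq)

1≺3·1 : ι 1 ≺ ι 3 · ι 1
1≺3·1 = subst (ι 1 ≺_) (sym (·-identityʳ (ι 3))) (ι-mono-< (s≤s (s≤s z≤n)))

level-step-≺1 : ∀ i y → y ≺ ι 1 → level-step i y ≡ ι (3 ^ i)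
level-step-≺1 zero y y≺1 = ℚ.≤-antisym
  (subst (nextVal y ≼_) val-three (next-least y three (subst (y ≺_) (sym val-three) y≺1))) (1≼val (next y))
level-step-≺1 (suc i) y y≺1 = trans
  (cong (ι 3 ·_) (level-step-≺1 i (third y) (third≺ (ℚ.<-trans y≺1 1≺3·1)))) (sym (ι-* 3 (3 ^ i)))

-- Enumeration of the defects

val-≤⁺ : ∀ a b → 3 ^ ones a * cube (eval b) ≤ 3 ^ ones b * cube (eval a) → val a ≼ val b
val-≤⁺ a b = frac-≤⁺ (val-isFrac a) (val-isFrac b)

val-≤⁻ : ∀ a b → val a ≼ val b → 3 ^ ones a * cube (eval b) ≤ 3 ^ ones b * cube (eval a)
val-≤⁻ a b = frac-≤⁻ (val-isFrac a) (val-isFrac b)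

val-cong : ∀ a b → ones a ≡ ones b → eval a ≡ eval b → val a ≡ val b
val-cong a b p q = frac-≡⁺ (val-isFrac a) (val-isFrac b) (cong₂ (λ c n → 3 ^ c * cube n) p (sym q))

eval-tower : ∀ k e → eval (tower k e) ≡ eval e
eval-tower zero e = refl
eval-tower (suc k) e = trans (*-identityˡ (eval (tower k e))) (eval-tower k e)

ones-tower : ∀ k e → ones (tower k e) ≡ k + ones e
ones-tower zero e = refl
ones-tower (suc k) e = cong suc (ones-tower k e)

-- A cheaper expression for the same number, padded with factors 1 until it costs exactly one less
-- than `e`, would have a third of the value of `e`.
≢3val⇒optimal : ∀ e → (∀ q → val e ≢ ι 3 · val q) → Optimal e
≢3val⇒optimal e h = [ (λ p → contradiction p worse) , (λ opt → opt) ]′ (improve e)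
  where
  worse : ¬ ∃ λ e′ → eval e′ ≡ eval e × ones e′ < ones e
  worse (e′ , eq , lt) =
    let d , eqd = m≤n⇒∃[o]m+o≡n lt
    in h (tower d e′) (trans
         (val-cong e (one ⊗ tower d e′)
           (sym (trans (cong suc (trans (ones-tower d e′) (+-comm d (ones e′)))) eqd))
           (sym (trans (eval-tower (suc d) e′) eq)))
         (val-one⊗ (tower d e′)))

optimal-3val⇒ones≤ : ∀ o q → Optimal o → val o ≡ ι 3 · val q → ones o ≤ ones q
optimal-3val⇒ones≤ o q opt eq = optimal⇒ones≤ o q opt
  (trans (cong (3 ^ ones o *_) (sym (*-identityˡ (cube (eval q)))))
    (≤-antisym (frac-≤⁻ (val-isFrac o) fq (ℚ.≤-reflexive eq)) (frac-≤⁻ fq (val-isFrac o) (ℚ.≤-reflexive (sym eq)))))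
  where
  fq : IsFrac (ι 3 · val q) (3 * 3 ^ ones q) (1 * cube (eval q))
  fq = frac-· (ι-isFrac 3) (val-isFrac q)

-- Outside 3P the expression `e` itself serves. If `val e` is 3 · `val q`, an optimal expression of
-- that value has at most `ones q` ones, so a finite list is searched.
optimal-at? : ∀ e → Dec (∃ λ o → Optimal o × val o ≡ val e)
optimal-at? e = cases (inP? (third (val e)))
  where
  3val : ∀ {q} → val q ≡ third (val e) → val e ≡ ι 3 · val q
  3val eq = trans (sym (3-third (val e))) (cong (ι 3 ·_) (sym eq))
  cases : Dec (InP (third (val e))) → Dec (∃ λ o → Optimal o × val o ≡ val e)
  cases (no ¬p) = yes (e , ≢3val⇒optimal e (λ q eq → ¬p (q , trans (sym (third-3 (val q))) (cong third (sym eq)))) , refl)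
  cases (yes (q , eq)) = search (any? (λ o → optimal? o ×-dec (val o ℚ.≟ val e)) (exprs (ones q)))
    where
    search : Dec (Any (λ o → Optimal o × val o ≡ val e) (exprs (ones q))) → Dec (∃ λ o → Optimal o × val o ≡ val e)
    search (yes p) = yes (Any.satisfied p)
    search (no ¬p) = no λ { (o , opt , eq′) →
      ¬p (lose (∈-exprs (ones q) o (optimal-3val⇒ones≤ o q opt (trans eq′ (3val eq)))) (opt , eq′)) }

-- The interval is half-open so that consecutive enumerations can be glued without overlap.
record Enum (lo hi : ℚ) (k : ℕ) : Set where
  field
    at         : Vec ℕ k → Expr
    at-optimal : ∀ v → Optimal (at v)
    at-≽       : ∀ v → lo ≼ val (at v)
    at-≺       : ∀ v → val (at v) ≺ hi
    at-mono    : ∀ v w → v <lex w → val (at v) ≺ val (at w)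
    at-onto    : ∀ e → Optimal e → lo ≼ val e → val e ≺ hi → ∃ λ v → val (at v) ≡ val e

enum-sequence : ∀ {lo hi} (f : ℕ → Expr) → (∀ n → Optimal (f n)) → (∀ n → lo ≼ val (f n)) → (∀ n → val (f n) ≺ hi) →
  (∀ n → val (f n) ≺ val (f (suc n))) →
  (∀ e → Optimal e → lo ≼ val e → val e ≺ hi → ∃ λ n → val (f n) ≡ val e) → Enum lo hi 1
enum-sequence f opt f≽ f≺ f-step f-onto = record
  { at = λ { (n ∷ []) → f n }
  ; at-optimal = λ { (n ∷ []) → opt n }
  ; at-≽ = λ { (n ∷ []) → f≽ n }
  ; at-≺ = λ { (n ∷ []) → f≺ n }
  ; at-mono = λ { (m ∷ []) (n ∷ []) (inj₁ m<n) → mono (≤⇒≤′ m<n) ; (_ ∷ []) (_ ∷ []) (inj₂ (_ , ())) }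
  ; at-onto = λ e o p q → let n , eq = f-onto e o p q in n ∷ [] , eq
  }
  where
  mono : ∀ {m n} → suc m ≤′ n → val (f m) ≺ val (f n)
  mono {m} (≤′-reflexive refl) = f-step m
  mono {n = suc n} (≤′-step p) = ℚ.<-trans (mono p) (f-step n)

-- Strictly between `c` and the next point of 3P every value avoids 3P and is therefore a defect.
-- Only `c` itself is in doubt: the sequence starts at `c` or just after it, and has type ω either
-- way.
enum-base : ∀ c → InP c → Enum c (level-step 1 c) 1
enum-base c (e₀ , eq₀) = cases (optimal-at? e₀)
  where
  open Fundamental fundamental-next
  p : ℕ → Expr
  p n = next (iter nextVal n c)
  c≺p : ∀ n → c ≺ val (p n)
  c≺p n = ℚ.≤-<-trans (iter-≽ n c) (≺next (iter nextVal n c))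
  p≺ : ∀ n → val (p n) ≺ level-step 1 c
  p≺ n = iter-≺ (suc n) c
  p-optimal : ∀ n → Optimal (p n)
  p-optimal n = ≢3val⇒optimal (p n) λ q eq →
    ≺⇒⋡ (p≺ n) (subst (level-step 1 c ≼_) (sym eq)
      (·-monoʳ-≼ 0≺3 (next-least (third c) q (third≺ (subst (c ≺_) eq (c≺p n))))))
  p-onto : ∀ e → c ≺ val e → val e ≺ level-step 1 c → ∃ λ n → val (p n) ≡ val e
  p-onto e c≺e e≺ = hit (locate c (val e) (ℚ.<⇒≤ c≺e) e≺)
    where
    hit : (∃ λ n → iter nextVal n c ≼ val e × val e ≺ iter nextVal (suc n) c) → ∃ λ n → val (p n) ≡ val e
    hit (zero , _ , e≺p) = contradiction (next-least c e c≺e) (≺⇒⋡ e≺p)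
    hit (suc n , p≼e , e≺p) = n , ℚ.≤-antisym p≼e
      ([ (λ p≺e → contradiction (next-least (val (p n)) e p≺e) (≺⇒⋡ e≺p)) , (λ h → h) ]′
        (≺-or-≽ (val (p n)) (val e)))
  cases : Dec (∃ λ o → Optimal o × val o ≡ val e₀) → Enum c (level-step 1 c) 1
  cases (no ¬o) = enum-sequence p p-optimal (λ n → ℚ.<⇒≤ (c≺p n)) p≺ (λ n → ≺next (val (p n)))
    λ e o c≼e e≺ → [ (λ c≺e → p-onto e c≺e e≺) ,
      (λ e≼c → contradiction (e , o , trans (ℚ.≤-antisym e≼c c≼e) (sym eq₀)) ¬o) ]′ (≺-or-≽ c (val e))
  cases (yes (o , opt , eq)) = enum-sequence f f-optimal f≽ f≺ f-step f-onto
    where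
    o≡c : val o ≡ c
    o≡c = trans eq eq₀
    f : ℕ → Expr
    f zero = o
    f (suc n) = p n
    f-optimal : ∀ n → Optimal (f n)
    f-optimal zero = opt
    f-optimal (suc n) = p-optimal n
    f≽ : ∀ n → c ≼ val (f n)
    f≽ zero = ℚ.≤-reflexive (sym o≡c)
    f≽ (suc n) = ℚ.<⇒≤ (c≺p n)
    f≺ : ∀ n → val (f n) ≺ level-step 1 c
    f≺ zero = subst (_≺ level-step 1 c) (sym o≡c) (≺lim c)
    f≺ (suc n) = p≺ n
    f-step : ∀ n → val (f n) ≺ val (f (suc n))
    f-step zero = subst (_≺ val (p 0)) (sym o≡c) (c≺p 0)
    f-step (suc n) = ≺next (val (p n))
    f-onto : ∀ e → Optimal e → c ≼ val e → val e ≺ level-step 1 c → ∃ λ n → val (f n) ≡ val e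
    f-onto e _ c≼e e≺ with ≺-or-≽ c (val e)
    ... | inj₁ c≺e = let n , eq′ = p-onto e c≺e e≺ in suc n , eq′
    ... | inj₂ e≼c = 0 , trans o≡c (ℚ.≤-antisym c≼e e≼c)

-- The orbit of `c` cuts the interval into ω consecutive segments of type ωᵏ; the first coordinate
-- names the segment.
enum-glue : ∀ {s ℓ} → Fundamental s ℓ → ∀ c k → (∀ n → Enum (iter s n c) (iter s (suc n) c) k) → Enum c (ℓ c) (suc k)
enum-glue {s} {ℓ} F c k segment = record
  { at = λ { (n ∷ v) → S.at n v }
  ; at-optimal = λ { (n ∷ v) → S.at-optimal n v }
  ; at-≽ = λ { (n ∷ v) → ℚ.≤-trans (iter-≽ n c) (S.at-≽ n v) }
  ; at-≺ = λ { (n ∷ v) → ℚ.<-trans (S.at-≺ n v) (iter-≺ (suc n) c) }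
  ; at-mono = λ { (m ∷ v) (n ∷ w) (inj₁ m<n) → ℚ.<-≤-trans (S.at-≺ m v) (ℚ.≤-trans (iter-mono c m<n) (S.at-≽ n w))
                ; (m ∷ v) (.m ∷ w) (inj₂ (refl , v<w)) → S.at-mono m v w v<w }
  ; at-onto = λ e o c≼e e≺ →
      let n , ≼e , e≺′ = locate c (val e) c≼e e≺
          v , eq = S.at-onto n e o ≼e e≺′
      in n ∷ v , eq
  }
  where
  open Fundamental F
  module S n = Enum (segment n)

inP-iter : ∀ i n c → InP c → InP (iter (level-step i) n c)
inP-iter i zero c h = h
inP-iter i (suc n) c h = inP-level-step i (iter (level-step i) n c)

-- The orbit under the successor in 3ⁱ⁺¹P is cofinal in the next point of 3ⁱ⁺²P, and each of its
-- segments is an instance of the previous case. The start `c` need only lie in P, which allows 1.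
enum : ∀ i c → InP c → Enum c (level-step (suc i) c) (suc i)
enum zero c h = enum-base c h
enum (suc i) c h = enum-glue (fundamental (suc i)) c (suc i)
  λ n → enum i (iter (level-step (suc i)) n c) (inP-iter (suc i) n c h)

-- The next point after 1 is three times the first point of 3ⁱP above 1/3, which is 3ⁱ because P
-- begins at 1.
level-step-1 : ∀ i → level-step (suc i) (ι 1) ≡ ι (3 ^ suc i)
level-step-1 i = trans (cong (ι 3 ·_) (level-step-≺1 i (third (ι 1)) (third≺ 1≺3·1))) (sym (ι-* 3 (3 ^ i)))

enum-1 : ∀ i → Enum (ι 1) (ι (3 ^ suc i)) (suc i)
enum-1 i = subst (λ hi → Enum (ι 1) hi (suc i)) (level-step-1 i) (enum i (ι 1) (three , val-three))

-- Order types of the sets of defects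

optimal⇒isCpx : ∀ e → Optimal e → IsCpx (eval e) (ones e)
optimal⇒isCpx e opt = (e , refl , refl) , opt

isCpx-unique : ∀ {n c d} → IsCpx n c → IsCpx n d → c ≡ d
isCpx-unique ((e , p , q) , f) ((e′ , p′ , q′) , g) =
  ≤-antisym (subst (_ ≤_) q′ (f e′ p′)) (subst (_ ≤_) q (g e p))

defectLe⁺ : ∀ a b → Optimal a → Optimal b → val a ≼ val b → DefectLe (eval a) (eval b)
defectLe⁺ a b oa ob h ca cb pa pb
  with isCpx-unique pa (optimal⇒isCpx a oa) | isCpx-unique pb (optimal⇒isCpx b ob)
... | refl | refl = val-≤⁻ a b h

defectLe⁻ : ∀ a b → Optimal a → Optimal b → DefectLe (eval a) (eval b) → val a ≼ val b
defectLe⁻ a b oa ob h = val-≤⁺ a b (h (ones a) (ones b) (optimal⇒isCpx a oa) (optimal⇒isCpx b ob))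

-- Trichotomy of the index order turns strict monotonicity into the required equivalence.
orderType : ∀ k {I : Set} (_<I_ : I → I → Set) (at : I → Expr) → (∀ i → Optimal (at i)) →
  (∀ i → val (at i) ≼ ι (3 ^ k)) →
  (∀ i j → i <I j → val (at i) ≺ val (at j)) →
  (∀ i j → i <I j ⊎ i ≡ j ⊎ j <I i) →
  (∀ e → Optimal e → val e ≼ ι (3 ^ k) → ∃ λ i → val (at i) ≡ val e) →
  HasOrderType k I _<I_
orderType k {I} _<I_ at opt at≼ mono compare onto =
  (λ i → eval (at i)) , inside , (λ i j → forward i j , backward i j) , hit
  where
  f3^k : IsFrac (ι (3 ^ k)) (3 ^ k) 1
  f3^k = ι-isFrac (3 ^ k)
  inside : ∀ i → DefectIn0k k (eval (at i))
  inside i = ones (at i) , optimal⇒isCpx (at i) (opt i) , cube≤3^ones (at i) ,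
    subst (_≤ 3 ^ k * cube (eval (at i))) (*-identityʳ _) (frac-≤⁻ (val-isFrac (at i)) f3^k (at≼ i))
  forward : ∀ i j → i <I j → DefectLt (eval (at i)) (eval (at j))
  forward i j i<j = defectLe⁺ (at i) (at j) (opt i) (opt j) (ℚ.<⇒≤ (mono i j i<j)) ,
    λ le → ≺⇒⋡ (mono i j i<j) (defectLe⁻ (at j) (at i) (opt j) (opt i) le)
  backward : ∀ i j → DefectLt (eval (at i)) (eval (at j)) → i <I j
  backward i j (le , ¬ge) = [ (λ lt → lt) , [ (λ { refl → contradiction le ¬ge }) ,
    (λ gt → contradiction (defectLe⁺ (at j) (at i) (opt j) (opt i) (ℚ.<⇒≤ (mono j i gt))) ¬ge) ]′ ]′ (compare i j)
  hit : ∀ n → DefectIn0k k n → Σ I λ i → DefectEq n (eval (at i))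
  hit n (c , ((e , refl , refl) , oe) , _ , h) =
    let i , eq = onto e oe (frac-≤⁺ (val-isFrac e) f3^k (subst (_≤ 3 ^ k * cube (eval e)) (sym (*-identityʳ _)) h))
    in i , defectLe⁺ e (at i) oe (opt i) (ℚ.≤-reflexive (sym eq)) ,
           defectLe⁺ (at i) e (opt i) oe (ℚ.≤-reflexive eq)

<lex-compare : ∀ {k} (v w : Vec ℕ k) → v <lex w ⊎ v ≡ w ⊎ w <lex v
<lex-compare [] [] = inj₂ (inj₁ refl)
<lex-compare (m ∷ v) (n ∷ w) with <-cmp m n
... | tri< m<n _ _ = inj₁ (inj₁ m<n)
... | tri> _ _ n<m = inj₂ (inj₂ (inj₁ n<m))
... | tri≈ _ refl _ with <lex-compare v w
...   | inj₁ v<w = inj₁ (inj₂ (refl , v<w))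
...   | inj₂ (inj₁ refl) = inj₂ (inj₁ refl)
...   | inj₂ (inj₂ w<v) = inj₂ (inj₂ (inj₂ (refl , w<v)))

<ω+1-compare : ∀ x y → x <ω+1 y ⊎ x ≡ y ⊎ y <ω+1 x
<ω+1-compare (just m) (just n) with <-cmp m n
... | tri< m<n _ _ = inj₁ m<n
... | tri≈ _ refl _ = inj₂ (inj₁ refl)
... | tri> _ _ n<m = inj₂ (inj₂ n<m)
<ω+1-compare (just _) nothing = inj₁ tt
<ω+1-compare nothing (just _) = inj₂ (inj₂ tt)
<ω+1-compare nothing nothing = inj₂ (inj₁ refl)

optimal-three : Optimal three
optimal-three = ≢3val⇒optimal three λ q eq → ≺⇒⋡ 1≺3·1
  (subst (ι 3 · ι 1 ≼_) (trans (sym eq) val-three) (·-monoʳ-≼ 0≺3 (1≼val q)))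

order-type-0 : HasOrderType 0 (Vec ℕ 0) _<lex_
order-type-0 = orderType 0 _<lex_ (λ _ → three) (λ _ → optimal-three)
  (λ _ → ℚ.≤-reflexive val-three) (λ { [] [] () }) <lex-compare
  (λ e _ e≼1 → [] , trans val-three (ℚ.≤-antisym (1≼val e) e≼1))

-- The endpoint 1 is the defect of the number 1, which adds a top element to the ω defects below it.
order-type-1 : HasOrderType 1 (Maybe ℕ) _<ω+1_
order-type-1 = orderType 1 _<ω+1_ pick pick-optimal pick≼ pick-mono <ω+1-compare pick-onto
  where
  open Enum (enum-1 0)
  pick : Maybe ℕ → Expr
  pick (just n) = at (n ∷ [])
  pick nothing = one
  pick-optimal : ∀ x → Optimal (pick x)
  pick-optimal (just n) = at-optimal (n ∷ [])
  pick-optimal nothing = λ e _ → 1≤ones e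
  pick≼ : ∀ x → val (pick x) ≼ ι 3
  pick≼ (just n) = ℚ.<⇒≤ (at-≺ (n ∷ []))
  pick≼ nothing = ℚ.≤-reflexive val-one
  pick-mono : ∀ x y → x <ω+1 y → val (pick x) ≺ val (pick y)
  pick-mono (just m) (just n) m<n = at-mono (m ∷ []) (n ∷ []) (inj₁ m<n)
  pick-mono (just m) nothing _ = subst (val (at (m ∷ [])) ≺_) (sym val-one) (at-≺ (m ∷ []))
  pick-onto : ∀ e → Optimal e → val e ≼ ι 3 → ∃ λ x → val (pick x) ≡ val e
  pick-onto e o e≼3 = [ below , (λ 3≼e → nothing , trans val-one (ℚ.≤-antisym 3≼e e≼3)) ]′ (≺-or-≽ (val e) (ι 3))
    where
    below : val e ≺ ι 3 → ∃ λ x → val (pick x) ≡ val e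
    below e≺3 with at-onto e o (1≼val e) e≺3
    ... | n ∷ [] , eq = just n , eq

-- The value 3ʲ⁺¹ is attained with j + 1 ones, so an optimal expression of three times that value
-- has at most j + 1 ones. But value 3ʲ⁺² takes at least j + 2. Hence for k ≥ 2 the endpoint `k` is
-- not a defect.
no-optimal-at-3^ : ∀ j e → Optimal e → val e ≢ ι (3 ^ suc (suc j))
no-optimal-at-3^ j e opt eq = <⇒≱ (^-monoʳ-< 3 (s≤s (s≤s z≤n)) (s≤s short)) 3^≤
  where
  q = tower j one
  val-q : val q ≡ ι (3 ^ suc j)
  val-q = trans (val-tower j one) (trans (cong (ι (3 ^ j) ·_) val-one)
    (trans (sym (ι-* (3 ^ j) 3)) (cong ι (*-comm (3 ^ j) 3))))
  short : ones e ≤ suc j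
  short = subst (ones e ≤_) (trans (ones-tower j one) (+-comm j 1))
    (optimal-3val⇒ones≤ e q opt (trans eq (trans (ι-* 3 (3 ^ suc j)) (cong (ι 3 ·_) (sym val-q)))))
  3^≤ : 3 ^ suc (suc j) ≤ 3 ^ ones e
  3^≤ = ≤-trans (m≤m*n (3 ^ suc (suc j)) (cube (eval e)) {{>-nonZero (1≤cube e)}})
    (subst (3 ^ suc (suc j) * cube (eval e) ≤_) (*-identityʳ (3 ^ ones e))
      (frac-≤⁻ (ι-isFrac (3 ^ suc (suc j))) (val-isFrac e) (ℚ.≤-reflexive (sym eq))))

order-type-≥2 : ∀ j → HasOrderType (suc (suc j)) (Vec ℕ (suc (suc j))) _<lex_
order-type-≥2 j = orderType (suc (suc j)) _<lex_ at at-optimal (λ v → ℚ.<⇒≤ (at-≺ v)) at-mono <lex-compare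
  λ e o e≼ → at-onto e o (1≼val e) ([ (λ h → h) ,
    (λ h → contradiction (ℚ.≤-antisym e≼ h) (no-optimal-at-3^ j e o)) ]′ (≺-or-≽ (val e) (ι (3 ^ suc (suc j)))))
  where open Enum (enum-1 (suc j))

theorem6p6 : ((k : ℕ) → ¬ (k ≡ 1) → HasOrderType k (Vec ℕ k) _<lex_)
    × HasOrderType 1 (Maybe ℕ) _<ω+1_
theorem6p6 = ω^k , order-type-1
  where
  ω^k : ∀ k → ¬ (k ≡ 1) → HasOrderType k (Vec ℕ k) _<lex_
  ω^k zero _ = order-type-0
  ω^k (suc zero) k≢1 = contradiction refl k≢1
  ω^k (suc (suc j)) _ = order-type-≥2 j
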